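{- Each of the following statistics on set partitions exhibits the cyclic sieving phenomenon with respect to involutions having $F_{2n-1}$ fixed points: the number of non-exclusive records; the number of non-exclusive-record openers; crossings; nestings; crossings of opener type; nestings of opener type; the number of non-block-records (insiders and openers that are not block records); the number of openers that are not block records; overlaps; coverings.
   Context: $\Pi_n$ is the set of set partitions of $[n]$. $F_{2n-1}$ denotes the sequence $a_n$ with $a_0=a_1=1$ and $a_n=3a_{n-1}-a_{n-2}$ (odd-indexed Fibonacci numbers $1,1,2,5,13,34,\dots$). For $\pi\in\Pi_n$, an element $i$ is an opener if it is the smallest element of a block of size $\ge2$, a closer if it is the largest element of a block of size $\ge2$, an insider if it is in a block of size $\ge3$ and is neither its smallest nor largest element, a singleton if its block is $\{i\}$. For $i$ not the largest element of its block, its right neighbour is the next larger element of its block; such an $i$ is an exclusive record if its right neighbour is larger than the right neighbour of every $j<i$ that is not the largest element of its block. Non-exclusive records = elements that are not the largest of their block and are not exclusive records; non-exclusive-record openers = openers that are not exclusive records. The partition graph has an edge $\{a,b\}$ iff $a,b$ are consecutive elements of the same block. A crossing is a quadruple $i<j<k<l$ with edges $\{i,k\},\{j,l\}$; a nesting is $i<j<k<l$ with edges $\{i,l\},\{j,k\}$; it is of opener type if $j$ is an opener. An element $j$ that is an opener or insider is a block record if $\max$ of its block exceeds $\max$ of every block containing an element $<j$. For blocks $B_1,B_2$: $(B_1,B_2)$ is an overlap if $\min B_1<\min B_2<\max B_1<\max B_2$, a covering if $\min B_1<\min B_2<\max B_2<\max B_1$. Cyclic sieving for involutions: for an involution $\phi$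 on a finite set $X$ and polynomial $f$, $(X,\{\mathrm{id},\phi\},f)$ exhibits the CSP iff $f(1)=|X|$ and $f(-1)$ equals the number of fixed points of $\phi$; a statistic exhibits the CSP with respect to involutions having $a_n$ fixed points if for every $n\ge0$ and every involution $\phi$ of $\Pi_n$ with exactly $a_n$ fixed points, $(\Pi_n,\{\mathrm{id},\phi\},\sum_{\pi\in\Pi_n}q^{\mathrm{stat}(\pi)})$ exhibits the CSP.
   Formalization: In the definition of block record, the maximum of j's block is compared only with maxima of other blocks containing an element < j; read literally (own block included) no insider is a block record, and the claim for non-block-records fails at n=3 (f(−1)=3, not 5). -}

module Defs where

open import Data.Bool using (Bool; true; false; _∧_; _∨_; not; T; if_then_else_)
open import Data.Nat using (ℕ; zero; suc; _+_; _*_; _∸_; _<ᵇ_; _≡ᵇ_; _≤ᵇ_)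
open import Data.Integer as ℤ using (ℤ; +_; -[1+_])
open import Data.List using (List; []; _∷_; length; filterᵇ; upTo; map; concatMap; foldr)
open import Data.Bool.ListAction using (all; any)
open import Data.Nat.ListAction using (sum)
open import Data.Maybe using (Maybe; just; nothing)
open import Data.Vec using (Vec; toList)
import Data.Vec as V
open import Relation.Binary.PropositionalEquality using (_≡_)

countᵇ : {A : Set} → (A → Bool) → List A → ℕ
countᵇ p xs = length (filterᵇ p xs)

at : List ℕ → ℕ → ℕ
at []       _       = 0
at (x ∷ xs) zero    = x
at (x ∷ xs) (suc i) = at xs i

-- Set partitions of [n] (elements are encoded as 0 , … , n-1).
-- A partition is encoded by the vector m with m[i] = minimum of the
-- block containing i.  Valid vectors: m[i] ≤ i and m[m[i]] = m[i]
-- (these are exactly the "block-minimum" maps, in bijection with set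
-- partitions; i and j lie in the same block iff m[i] = m[j]).

validL : ℕ → List ℕ → Bool
validL n ms = all (λ i → (at ms i ≤ᵇ i) ∧ (at ms (at ms i) ≡ᵇ at ms i)) (upTo n)

record Π (n : ℕ) : Set where
  constructor mkΠ
  field
    vec   : Vec ℕ n
    valid : T (validL n (toList vec))
open Π public

vecsBelow : (n k : ℕ) → List (Vec ℕ n)
vecsBelow zero    k = V.[] ∷ []
vecsBelow (suc n) k = concatMap (λ x → map (λ v → x V.∷ v) (vecsBelow n k)) (upTo k)

collect : (n : ℕ) → List (Vec ℕ n) → List (Π n)
collect n [] = []
collect n (v ∷ vs) = add (validL n (toList v)) (mkΠ v) (collect n vs)
  where
  add : (b : Bool) → (T b → Π n) → List (Π n) → List (Π n)
  add true  f xs = f _ ∷ xs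
  add false f xs = xs

allΠ : (n : ℕ) → List (Π n)
allΠ n = collect n (vecsBelow n n)

module Structure (n : ℕ) (ms : List ℕ) where
  els : List ℕ
  els = upTo n

  same : ℕ → ℕ → Bool
  same i j = at ms i ≡ᵇ at ms j

  block : ℕ → List ℕ
  block i = filterᵇ (same i) els

  size : ℕ → ℕ
  size i = length (block i)

  maxOf : List ℕ → ℕ
  maxOf = foldr (λ x y → if y <ᵇ x then x else y) 0

  bmax : ℕ → ℕ
  bmax i = maxOf (block i)

  next : ℕ → Maybe ℕ
  next i with filterᵇ (λ j → (i <ᵇ j) ∧ same i j) els
  ... | []     = nothing
  ... | j ∷ _  = just j

  isMax : ℕ → Bool
  isMax i with next i
  ... | nothing = true
  ... | just _  = false

  isMin : ℕ → Bool
  isMin i = not (any (λ j → (j <ᵇ i) ∧ same i j) els)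

  nextℕ : ℕ → ℕ      -- right neighbour (only used when it exists)
  nextℕ i with next i
  ... | nothing = 0
  ... | just j  = j

  edge : ℕ → ℕ → Bool
  edge a b with next a
  ... | nothing = false
  ... | just c  = c ≡ᵇ b

  opener : ℕ → Bool
  opener i = isMin i ∧ (1 <ᵇ size i)

  insider : ℕ → Bool
  insider i = (2 <ᵇ size i) ∧ not (isMin i) ∧ not (isMax i)

  exclusiveRecord : ℕ → Bool
  exclusiveRecord i =
    not (isMax i) ∧ all (λ j → not ((j <ᵇ i) ∧ not (isMax j)) ∨ (nextℕ j <ᵇ nextℕ i)) els

  inc4 : ℕ → ℕ → ℕ → ℕ → Bool
  inc4 i j k l = (i <ᵇ j) ∧ (j <ᵇ k) ∧ (k <ᵇ l)

  count4 : (ℕ → ℕ → ℕ → ℕ → Bool) → ℕ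
  count4 p = sum (map (λ i → sum (map (λ j → sum (map (λ k → countᵇ (p i j k) els) els)) els)) els)

  count2 : List ℕ → (ℕ → ℕ → Bool) → ℕ
  count2 xs p = sum (map (λ a → countᵇ (p a) xs) xs)

  blockRecord : ℕ → Bool
  blockRecord j = (opener j ∨ insider j) ∧ all (λ i → not (i <ᵇ j) ∨ same i j ∨ (bmax i <ᵇ bmax j)) els

  mins : List ℕ
  mins = filterᵇ isMin els

  nonExclusiveRecords : ℕ
  nonExclusiveRecords = countᵇ (λ i → not (isMax i) ∧ not (exclusiveRecord i)) els

  nonExclusiveRecordOpeners : ℕ
  nonExclusiveRecordOpeners = countᵇ (λ i → opener i ∧ not (exclusiveRecord i)) els

  crossings : ℕ
  crossings = count4 (λ i j k l → inc4 i j k l ∧ edge i k ∧ edge j l)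

  nestings : ℕ
  nestings = count4 (λ i j k l → inc4 i j k l ∧ edge i l ∧ edge j k)

  openerCrossings : ℕ
  openerCrossings = count4 (λ i j k l → inc4 i j k l ∧ edge i k ∧ edge j l ∧ opener j)

  openerNestings : ℕ
  openerNestings = count4 (λ i j k l → inc4 i j k l ∧ edge i l ∧ edge j k ∧ opener j)

  nonBlockRecords : ℕ
  nonBlockRecords = countᵇ (λ j → (opener j ∨ insider j) ∧ not (blockRecord j)) els

  nonBlockRecordOpeners : ℕ
  nonBlockRecordOpeners = countᵇ (λ j → opener j ∧ not (blockRecord j)) els

  -- blocks are represented by their minima; (B₁,B₂) ranges over ordered pairs of blocks
  overlaps : ℕ
  overlaps = count2 mins (λ a b → (a <ᵇ b) ∧ (b <ᵇ bmax a) ∧ (bmax a <ᵇ bmax b))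

  coverings : ℕ
  coverings = count2 mins (λ a b → (a <ᵇ b) ∧ (b <ᵇ bmax b) ∧ (bmax b <ᵇ bmax a))

data Statistic : Set where
  nonExclRec nonExclRecOpener crossing nesting openerCrossing openerNesting
    nonBlockRec nonBlockRecOpener overlapping covering : Statistic

stat : Statistic → {n : ℕ} → Π n → ℕ
stat s {n} π = go s
  where
  open Structure n (toList (vec π))
  go : Statistic → ℕ
  go nonExclRec        = nonExclusiveRecords
  go nonExclRecOpener  = nonExclusiveRecordOpeners
  go crossing          = crossings
  go nesting           = nestings
  go openerCrossing    = openerCrossings
  go openerNesting     = openerNestings
  go nonBlockRec       = nonBlockRecords
  go nonBlockRecOpener = nonBlockRecordOpeners
  go overlapping       = overlaps
  go covering          = coverings

-- a_n = F_{2n-1}: a₀ = a₁ = 1, aₙ = 3aₙ₋₁ − aₙ₋₂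

oddFib : ℕ → ℕ
oddFib zero = 1
oddFib (suc zero) = 1
oddFib (suc (suc n)) = 3 * oddFib (suc n) ∸ oddFib n

genPoly : Statistic → (n : ℕ) → ℤ → ℤ
genPoly s n q = foldr (λ π acc → q ℤ.^ stat s π ℤ.+ acc) (+ 0) (allΠ n)

IsInvolution : {n : ℕ} → (Π n → Π n) → Set
IsInvolution φ = ∀ π → φ (φ π) ≡ π

-- number of fixed points of φ (a partition is determined by its vector)
fixedPoints : {n : ℕ} → (Π n → Π n) → ℕ
fixedPoints {n} φ = countᵇ (λ π → eqL (toList (vec (φ π))) (toList (vec π))) (allΠ n)
  where
  eqL : List ℕ → List ℕ → Bool
  eqL []       []       = true
  eqL (x ∷ xs) (y ∷ ys) = (x ≡ᵇ y) ∧ eqL xs ys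
  eqL _        _        = false

-- (Π_n, {id, φ}, f) exhibits the CSP
CSP : Statistic → (n : ℕ) → (Π n → Π n) → Set
CSP s n φ = (genPoly s n (+ 1) ≡ + length (allΠ n)) × (genPoly s n (ℤ.- (+ 1)) ≡ + fixedPoints φ)
  where open import Data.Product using (_×_)

ExhibitsCSP : Statistic → (ℕ → ℕ) → Set
ExhibitsCSP s a = (n : ℕ) (φ : Π n → Π n) → IsInvolution φ → fixedPoints φ ≡ a n → CSP s n φ

{-# OPTIONS --safe #-}
module Submission where

-- A set partition, given by its word m of block minima, is flat if no block of size ≥ 2
-- opens strictly inside the span of another block.  If it is not flat, let j be the
-- smallest opener at which this fails: exactly one other block, with minimum a, spans j, and
-- exchanging the labels a and j at all positions > j is an involution.  Scanning from right
-- to left, each of the ten statistics is a sum of local weights: position x attaches to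
-- one of the arcs (or blocks) open at x, and its weight depends only on the relative
-- position of its choice among them.  The exchange alters just the choice at j, which is
-- between two options of weights 0 and 1, so it changes the statistic by ±1.  Hence the
-- value at q = −1 is the number of flat partitions, on which all statistics vanish; a
-- recursion on the labels still available shows that there are F₂ₙ₋₁ of them.

open import Defs
open import Data.Bool using (Bool; true; false; _∧_; _∨_; not; T; if_then_else_)
open import Data.Bool.ListAction using (all; any)
open import Data.Bool.Properties using (T-irrelevant)
open import Data.Empty using (⊥-elim)
open import Data.Fin using (toℕ)
open import Data.Integer as ℤ using (ℤ) renaming (+_ to pos)
import Data.Integer.Properties as ℤ
open import Data.List using (List; []; _∷_; length; filterᵇ; upTo; map; _++_; concatMap; foldr)
open import Data.List.Membership.Propositional using (_∈_)
open import Data.List.Membership.Propositional.Properties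
  using (∈-map⁺; ∈-map⁻; ∈-upTo⁺; ∈-upTo⁻; ∈-filter⁺; ∈-filter⁻; ∈-concat⁺′)
open import Data.List.Membership.Propositional.Properties.WithK using (unique∧set⇒bag)
open import Data.List.Properties using (map-∘; map-++)
open import Data.List.Relation.Binary.BagAndSetEquality using (∼bag⇒↭)
open import Data.List.Relation.Binary.Disjoint.Propositional using (Disjoint)
open import Data.List.Relation.Binary.Permutation.Propositional as ↭ using (_↭_)
open import Data.List.Relation.Binary.Permutation.Propositional.Properties using (map⁺)
open import Data.List.Relation.Unary.All as All using (All; []; _∷_)
import Data.List.Relation.Unary.All.Properties as All
open import Data.List.Relation.Unary.AllPairs as AllPairs using (AllPairs; []; _∷_)
import Data.List.Relation.Unary.AllPairs.Properties as AllPairs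
open import Data.List.Relation.Unary.Any using (here; there)
open import Data.List.Relation.Unary.Unique.Propositional using (Unique)
import Data.List.Relation.Unary.Unique.Propositional.Properties as Unique
open import Data.Maybe using (just; nothing)
open import Data.Nat
open import Data.Nat.ListAction using (sum)
open import Data.Nat.ListAction.Properties using (sum-↭; sum-++)
open import Data.Nat.Properties
open import Algebra.Properties.CommutativeSemigroup +-commutativeSemigroup using (interchange; x∙yz≈y∙xz)
import Algebra.Properties.CommutativeSemigroup ℤ.+-commutativeSemigroup as ℤ+
open import Data.Nat.Tactic.RingSolver using (solve-∀)
open import Data.Product using (∃; ∃₂; _×_; _,_; proj₁; proj₂)
open import Data.Sum using (_⊎_; inj₁; inj₂)
open import Data.Vec using (Vec; toList; tabulate)
import Data.Vec as Vec
open import Data.Vec.Properties using (∷-injective; length-toList)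
open import Function using (_∘_; id; mk⇔)
open import Relation.Binary.Definitions using (tri<; tri≈; tri>)
open import Relation.Binary.PropositionalEquality
open import Relation.Nullary using (¬_; yes; no; contradiction; T?)
open import Relation.Nullary.Decidable using (_×-dec_)
open import Relation.Nullary.Reflects
  using (Reflects; ofʸ; ofⁿ; _×-reflects_; _⊎-reflects_; ¬-reflects; T-reflects)
open import Relation.Unary using (Decidable)

-- The minimality of `j` does three jobs. It makes every position before `j` weightless, both before
-- and after the exchange. It makes the block spanning `j` unique: of two labels below `j` that are
-- open across `j`, the larger would itself be a bad opener. And it survives the exchange: both `a`
-- and `j` occur after `j`, so the labels occurring there are the same in both words; the same pair
-- is found again, and the second exchange undoes the first. Beyond `j` weights are unchanged
-- because the exchange permutes the starts of the open arcs or blocks while keeping their ends, so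
-- each position compares itself with the same ends. As defined, the ten statistics have little in
-- common. The sign argument is therefore carried out once, for an abstract guard, set of sources
-- and map to ends, and each statistic is then identified with such a total. Counting meets another
-- obstacle: badness looks ahead in the word, so it is first replaced by a condition on what
-- precedes a position.

reflects⇒≡ : ∀ {P Q : Set} {a b} → Reflects P a → Reflects Q b → (P → Q) → (Q → P) → a ≡ b
reflects⇒≡ (ofʸ p) (ofʸ q) f g = refl
reflects⇒≡ (ofʸ p) (ofⁿ q) f g = contradiction (f p) q
reflects⇒≡ (ofⁿ p) (ofʸ q) f g = contradiction (g q) p
reflects⇒≡ (ofⁿ p) (ofⁿ q) f g = refl

reflects-map : ∀ {P Q : Set} {b} → (P → Q) → (Q → P) → Reflects P b → Reflects Q b
reflects-map f g (ofʸ p)  = ofʸ (f p)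
reflects-map f g (ofⁿ ¬p) = ofⁿ (¬p ∘ g)

reflects⇒T : ∀ {P : Set} {b} → Reflects P b → P → T b
reflects⇒T (ofʸ _)  _ = _
reflects⇒T (ofⁿ ¬p) p = ¬p p

T⇒reflects : ∀ {P : Set} {b} → Reflects P b → T b → P
T⇒reflects (ofʸ p) _ = p

≡ᵇ-reflects : ∀ x y → Reflects (x ≡ y) (x ≡ᵇ y)
≡ᵇ-reflects zero    zero    = ofʸ refl
≡ᵇ-reflects zero    (suc y) = ofⁿ λ ()
≡ᵇ-reflects (suc x) zero    = ofⁿ λ ()
≡ᵇ-reflects (suc x) (suc y) = reflects-map (cong suc) suc-injective (≡ᵇ-reflects x y)

module _ {A : Set} where

  all-reflects : ∀ {P : A → Set} {p} xs → (∀ x → x ∈ xs → Reflects (P x) (p x)) →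
                 Reflects (∀ x → x ∈ xs → P x) (all p xs)
  all-reflects [] r = ofʸ λ _ ()
  all-reflects {p = p} (x ∷ xs) r with p x | r x (here refl)
  ... | false | ofⁿ ¬p = ofⁿ λ h → ¬p (h x (here refl))
  ... | true  | ofʸ px = reflects-map (λ h → λ { y (here refl) → px ; y (there y∈) → h y y∈ })
                           (λ h y y∈ → h y (there y∈)) (all-reflects xs λ y y∈ → r y (there y∈))

  any-reflects : ∀ {P : A → Set} {p} xs → (∀ x → x ∈ xs → Reflects (P x) (p x)) →
                 Reflects (∃ λ x → x ∈ xs × P x) (any p xs)
  any-reflects [] r = ofⁿ λ ()
  any-reflects {p = p} (x ∷ xs) r with p x | r x (here refl)
  ... | true  | ofʸ px = ofʸ (x , here refl , px)
  ... | false | ofⁿ ¬p = reflects-map (λ { (y , y∈ , py) → y , there y∈ , py })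
                           (λ { (y , here refl , py) → contradiction py ¬p ; (y , there y∈ , py) → y , y∈ , py })
                           (any-reflects xs λ y y∈ → r y (there y∈))

-- Sums over lists

𝟙 : Bool → ℕ
𝟙 b = if b then 1 else 0

∑ : {A : Set} → List A → (A → ℕ) → ℕ
∑ xs f = sum (map f xs)

module _ {A : Set} where

  count-∑ : ∀ p (xs : List A) → countᵇ p xs ≡ ∑ xs (𝟙 ∘ p)
  count-∑ p [] = refl
  count-∑ p (x ∷ xs) with p x
  ... | true  = cong suc (count-∑ p xs)
  ... | false = count-∑ p xs

  ∑-filter : ∀ p (xs : List A) f → ∑ (filterᵇ p xs) f ≡ ∑ xs λ x → if p x then f x else 0
  ∑-filter p [] f = refl
  ∑-filter p (x ∷ xs) f with p x
  ... | true  = cong (f x +_) (∑-filter p xs f)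
  ... | false = ∑-filter p xs f

  ∑-cong : ∀ (xs : List A) {f g} → (∀ x → x ∈ xs → f x ≡ g x) → ∑ xs f ≡ ∑ xs g
  ∑-cong [] h = refl
  ∑-cong (x ∷ xs) h = cong₂ _+_ (h x (here refl)) (∑-cong xs λ y y∈ → h y (there y∈))

  ∑-zero : ∀ (xs : List A) {f} → (∀ x → x ∈ xs → f x ≡ 0) → ∑ xs f ≡ 0
  ∑-zero [] h = refl
  ∑-zero (x ∷ xs) h = cong₂ _+_ (h x (here refl)) (∑-zero xs λ y y∈ → h y (there y∈))

  ∑-distrib-+ : ∀ (xs : List A) f g → ∑ xs (λ x → f x + g x) ≡ ∑ xs f + ∑ xs g
  ∑-distrib-+ [] f g = refl
  ∑-distrib-+ (x ∷ xs) f g = begin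
    f x + g x + ∑ xs (λ x → f x + g x)  ≡⟨ cong (f x + g x +_) (∑-distrib-+ xs f g) ⟩
    f x + g x + (∑ xs f + ∑ xs g)       ≡⟨ interchange (f x) (g x) (∑ xs f) (∑ xs g) ⟩
    f x + ∑ xs f + (g x + ∑ xs g)       ∎
    where open ≡-Reasoning

  ∑-if : ∀ b (xs : List A) p → (if b then countᵇ p xs else 0) ≡ ∑ xs λ x → 𝟙 (b ∧ p x)
  ∑-if true  xs p = count-∑ p xs
  ∑-if false xs p = sym (∑-zero xs λ _ _ → refl)

  -- Isolates the one index at which two summands may differ, so that two totals can be compared
  -- through a common remainder `r`.
  ∑-common : ∀ {xs : List A} {j} f g → Unique xs → j ∈ xs → (∀ x → x ∈ xs → x ≢ j → f x ≡ g x) →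
             ∃ λ r → ∑ xs f ≡ f j + r × ∑ xs g ≡ g j + r
  ∑-common {x ∷ xs} f g (x∉ ∷ _) (here refl) h =
    ∑ xs f , refl ,
    cong (g x +_) (sym (∑-cong xs λ y y∈ → h y (there y∈) (≢-sym (All.lookup x∉ y∈))))
  ∑-common {x ∷ xs} {j} f g (x∉ ∷ u) (there j∈) h
    with r , ef , eg ← ∑-common f g u j∈ (λ y y∈ → h y (there y∈)) =
    f x + r , shift f ef ,
    trans (shift g eg) (cong (λ z → g j + (z + r)) (sym (h x (here refl) (All.lookup x∉ j∈))))
    where
    shift : ∀ f → ∑ xs f ≡ f j + r → f x + ∑ xs f ≡ f j + (f x + r)
    shift f e = trans (cong (f x +_) e) (x∙yz≈y∙xz (f x) (f j) r)

  ∑-point : ∀ {xs : List A} {j} f → Unique xs → j ∈ xs → (∀ x → x ∈ xs → x ≢ j → f x ≡ 0) →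
            ∑ xs f ≡ f j
  ∑-point {xs} {j} f u j∈ h with r , ef , e0 ← ∑-common f (λ _ → 0) u j∈ h =
    trans ef (trans (cong (f j +_) (trans (sym e0) (∑-zero xs λ _ _ → refl))) (+-identityʳ _))

  1⊓count : ∀ {b} {p : A → Bool} xs → Reflects (∃ λ x → x ∈ xs × T (p x)) b → 1 ⊓ countᵇ p xs ≡ 𝟙 b
  1⊓count [] (ofʸ ())
  1⊓count [] (ofⁿ _) = refl
  1⊓count {p = p} (x ∷ xs) r with p x in eq
  1⊓count (x ∷ xs) (ofʸ _)  | true = refl
  1⊓count (x ∷ xs) (ofⁿ ¬e) | true = contradiction (x , here refl , subst T (sym eq) _) ¬e
  ... | false = 1⊓count xs (reflects-map
      (λ { (y , here refl , py) → ⊥-elim (subst T eq py) ; (y , there y∈ , py) → y , y∈ , py })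
      (λ { (y , y∈ , py) → y , there y∈ , py }) r)

  -- The reindexing principle used both for the transposition of positions and for the exchange on
  -- partitions. Both lists are free of repetitions and have the same elements.
  involution-↭ : ∀ {xs : List A} {τ} → Unique xs → (∀ x → x ∈ xs → τ x ∈ xs) → (∀ x → τ (τ x) ≡ x) →
                 map τ xs ↭ xs
  involution-↭ {xs} {τ} u closed inv = ∼bag⇒↭ (unique∧set⇒bag (Unique.map⁺ inj u) u (mk⇔ to from))
    where
    inj : ∀ {x y} → τ x ≡ τ y → x ≡ y
    inj e = trans (sym (inv _)) (trans (cong τ e) (inv _))
    to : ∀ {x} → x ∈ map τ xs → x ∈ xs
    to x∈ with y , y∈ , refl ← ∈-map⁻ τ x∈ = closed y y∈
    from : ∀ {x} → x ∈ xs → x ∈ map τ xs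
    from x∈ = subst (_∈ map τ xs) (inv _) (∈-map⁺ τ (closed _ x∈))

module _ {A B : Set} where

  ∑-swap : ∀ (xs : List A) (ys : List B) (f : A → B → ℕ) → ∑ xs (λ x → ∑ ys (f x)) ≡ ∑ ys (λ y → ∑ xs λ x → f x y)
  ∑-swap [] ys f = sym (∑-zero ys λ _ _ → refl)
  ∑-swap (x ∷ xs) ys f =
    trans (cong (∑ ys (f x) +_) (∑-swap xs ys f)) (sym (∑-distrib-+ ys (f x) _))

  ∑-map : ∀ (h : A → B) xs f → ∑ (map h xs) f ≡ ∑ xs (f ∘ h)
  ∑-map h xs f = cong sum (sym (map-∘ xs))

  ∑-concatMap : ∀ (h : A → List B) xs f → ∑ (concatMap h xs) f ≡ ∑ xs λ x → ∑ (h x) f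
  ∑-concatMap h [] f = refl
  ∑-concatMap h (x ∷ xs) f = begin
    ∑ (h x ++ concatMap h xs) f          ≡⟨ cong sum (map-++ f (h x) (concatMap h xs)) ⟩
    sum (map f (h x) ++ map f (concatMap h xs)) ≡⟨ sum-++ (map f (h x)) _ ⟩
    ∑ (h x) f + ∑ (concatMap h xs) f     ≡⟨ cong (∑ (h x) f +_) (∑-concatMap h xs f) ⟩
    ∑ (h x) f + ∑ xs (λ x → ∑ (h x) f)   ∎
    where open ≡-Reasoning

𝟙-true : ∀ {P : Set} {b} → P → Reflects P b → 𝟙 b ≡ 1
𝟙-true p (ofʸ _)  = refl
𝟙-true p (ofⁿ ¬p) = contradiction p ¬p

𝟙-false : ∀ {P : Set} {b} → ¬ P → Reflects P b → 𝟙 b ≡ 0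
𝟙-false ¬p (ofʸ p) = contradiction p ¬p
𝟙-false ¬p (ofⁿ _) = refl

count-zero : ∀ {A : Set} {P : A → Set} {p} xs → (∀ x → x ∈ xs → Reflects (P x) (p x)) →
             (∀ x → x ∈ xs → ¬ P x) → countᵇ p xs ≡ 0
count-zero {p = p} xs r none =
  trans (count-∑ p xs) (∑-zero xs λ x x∈ → 𝟙-false (none x x∈) (r x x∈))

count-point : ∀ {A : Set} {P : A → Set} {p xs j} → Unique xs → (∀ x → x ∈ xs → Reflects (P x) (p x)) →
              j ∈ xs → (∀ x → x ∈ xs → P x → x ≡ j) → countᵇ p xs ≡ 𝟙 (p j)
count-point {p = p} {xs} u r j∈ only = trans (count-∑ p xs)
  (∑-point (𝟙 ∘ p) u j∈ λ x x∈ x≢j → 𝟙-false (x≢j ∘ only x x∈) (r x x∈))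

∑∑-point : ∀ {A : Set} {xs : List A} {Q : A → A → Set} {q : A → A → Bool} {b} → Unique xs →
           (∀ k l → Reflects (Q k l) (q k l)) →
           (∀ {k l k′ l′} → Q k l → Q k′ l′ → k ≡ k′ × l ≡ l′) →
           Reflects (∃₂ λ k l → k ∈ xs × l ∈ xs × Q k l) b →
           ∑ xs (λ k → countᵇ (q k) xs) ≡ 𝟙 b
∑∑-point {xs = xs} {Q} {q} u r unique (ofⁿ none) = ∑-zero xs λ k k∈ →
  count-zero xs (λ l _ → r k l) λ l l∈ Qkl → none (k , l , k∈ , l∈ , Qkl)
∑∑-point {xs = xs} {Q} {q} u r unique (ofʸ (k , l , k∈ , l∈ , Qkl)) = begin
  ∑ xs (λ k → countᵇ (q k) xs)  ≡⟨ ∑-point (λ k → countᵇ (q k) xs) u k∈ (λ k′ _ k′≢k →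
                                     count-zero xs (λ l′ _ → r k′ l′) λ l′ _ Q′ → k′≢k (proj₁ (unique Q′ Qkl))) ⟩
  countᵇ (q k) xs               ≡⟨ count-point u (λ l′ _ → r k l′) l∈ (λ l′ _ Q′ → proj₂ (unique Q′ Qkl)) ⟩
  𝟙 (q k l)                     ≡⟨ 𝟙-true Qkl (r k l) ⟩
  1                             ∎
  where open ≡-Reasoning

-- Filtered ranges and lists with few elements

module _ {p : ℕ → Bool} {n : ℕ} where

  ∈-filter-upTo⁺ : ∀ {i} → i < n → T (p i) → i ∈ filterᵇ p (upTo n)
  ∈-filter-upTo⁺ i<n = ∈-filter⁺ (T? ∘ p) (∈-upTo⁺ i<n)

  ∈-filter-upTo⁻ : ∀ {i} → i ∈ filterᵇ p (upTo n) → i < n × T (p i)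
  ∈-filter-upTo⁻ i∈ with i∈upTo , pi ← ∈-filter⁻ (T? ∘ p) i∈ = ∈-upTo⁻ i∈upTo , pi

  -- A filtered range is still increasing, so nothing satisfying `p` precedes its head. This
  -- identifies `next` as the nearest later element of the block.
  filter-upTo-head : ∀ {j js} → filterᵇ p (upTo n) ≡ j ∷ js →
                     j < n × T (p j) × ∀ {k} → k < j → ¬ T (p k)
  filter-upTo-head {j} {js} eq = proj₁ j-spec , proj₂ j-spec , λ k<j pk →
      minimal k<j (subst (_ ∈_) eq (∈-filter-upTo⁺ (<-trans k<j (proj₁ j-spec)) pk))
    where
    j-spec : j < n × T (p j)
    j-spec = ∈-filter-upTo⁻ (subst (j ∈_) (sym eq) (here refl))
    sorted : AllPairs _<_ (j ∷ js)
    sorted = subst (AllPairs _<_) eq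
      (AllPairs.filter⁺ (T? ∘ p) (AllPairs.applyUpTo⁺₁ id n λ i<j _ → i<j))
    minimal : ∀ {k} → k < j → ¬ k ∈ j ∷ js
    minimal k<j (here refl) = <-irrefl refl k<j
    minimal k<j (there k∈)  = <-asym k<j (All.lookup (AllPairs.head sorted) k∈)

∈²⇒1<length : ∀ {A : Set} {i k : A} xs → i ∈ xs → k ∈ xs → i ≢ k → 1 < length xs
∈²⇒1<length (x ∷ []) (here refl) (here refl) i≢k = contradiction refl i≢k
∈²⇒1<length (x ∷ y ∷ xs) _ _ _ = s≤s (s≤s z≤n)

∈³⇒2<length : ∀ {A : Set} {i j k : A} xs → i ∈ xs → j ∈ xs → k ∈ xs → i ≢ j → i ≢ k → j ≢ k → 2 < length xs
∈³⇒2<length (_ ∷ []) (here refl) (here refl) _ i≢j _ _ = contradiction refl i≢j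
∈³⇒2<length (_ ∷ _ ∷ []) (here refl) (here refl) _ i≢j _ _ = contradiction refl i≢j
∈³⇒2<length (_ ∷ _ ∷ []) (here refl) (there (here refl)) (here refl) _ i≢k _ = contradiction refl i≢k
∈³⇒2<length (_ ∷ _ ∷ []) (here refl) (there (here refl)) (there (here refl)) _ _ j≢k = contradiction refl j≢k
∈³⇒2<length (_ ∷ _ ∷ []) (there (here refl)) (here refl) (here refl) _ _ j≢k = contradiction refl j≢k
∈³⇒2<length (_ ∷ _ ∷ []) (there (here refl)) (here refl) (there (here refl)) _ i≢k _ = contradiction refl i≢k
∈³⇒2<length (_ ∷ _ ∷ []) (there (here refl)) (there (here refl)) _ i≢j _ _ = contradiction refl i≢j
∈³⇒2<length (_ ∷ _ ∷ _ ∷ _) _ _ _ _ _ _ = s≤s (s≤s (s≤s z≤n))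

1<length⇒∃≢ : ∀ {xs : List ℕ} i → Unique xs → 1 < length xs → ∃ λ k → k ∈ xs × k ≢ i
1<length⇒∃≢ {_ ∷ []} i _ (s≤s ())
1<length⇒∃≢ {x ∷ y ∷ xs} i ((x≢y ∷ _) ∷ _) _ with x ≟ i
... | no x≢i   = x , here refl , x≢i
... | yes refl = y , there (here refl) , ≢-sym x≢y

-- Words of block minima

module Word (n : ℕ) (m : ℕ → ℕ) where

  Valid : Set
  Valid = ∀ {i} → i < n → m i ≤ i × m (m i) ≡ m i

  Last : ℕ → Set
  Last i = ∀ {k} → i < k → k < n → m k ≢ m i

  Next : ℕ → ℕ → Set
  Next i b = i < b × b < n × m b ≡ m i × ∀ {k} → i < k → k < b → m k ≢ m i

  BlockMax : ℕ → ℕ → Set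
  BlockMax i b = b < n × m b ≡ m i × ∀ {k} → b < k → k < n → m k ≢ m i

  Next-unique : ∀ {i b c} → Next i b → Next i c → b ≡ c
  Next-unique {b = b} {c} (i<b , _ , eb , minb) (i<c , _ , ec , minc) with <-cmp b c
  ... | tri< b<c _ _ = contradiction eb (minc i<b b<c)
  ... | tri≈ _ b≡c _ = b≡c
  ... | tri> _ _ c<b = contradiction ec (minb i<c c<b)

  Next-injective : ∀ {i j b} → Next i b → Next j b → i ≡ j
  Next-injective {i} {j} (i<b , _ , ei , mini) (j<b , _ , ej , minj) with <-cmp i j
  ... | tri< i<j _ _ = contradiction (trans (sym ej) ei) (mini i<j j<b)
  ... | tri≈ _ i≡j _ = i≡j
  ... | tri> _ _ j<i = contradiction (trans (sym ei) ej) (minj j<i i<b)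

  BlockMax-unique : ∀ {i b c} → BlockMax i b → BlockMax i c → b ≡ c
  BlockMax-unique {b = b} {c} (b<n , eb , maxb) (c<n , ec , maxc) with <-cmp b c
  ... | tri< b<c _ _ = contradiction ec (maxb b<c c<n)
  ... | tri≈ _ b≡c _ = b≡c
  ... | tri> _ _ c<b = contradiction eb (maxc c<b b<n)

  BlockMax-cong : ∀ {i j b} → m i ≡ m j → BlockMax i b → BlockMax j b
  BlockMax-cong e (b<n , eb , maxb) = b<n , trans eb e , λ b<k k<n ek → maxb b<k k<n (trans ek (sym e))

  BlockMax-≥ : ∀ {i b k} → BlockMax i b → k < n → m k ≡ m i → k ≤ b
  BlockMax-≥ (_ , _ , maxb) k<n ek = ≮⇒≥ λ b<k → maxb b<k k<n ek

module Facts (n : ℕ) (ms : List ℕ) where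
  open Structure n ms
  open Word n (at ms)

  private
    m : ℕ → ℕ
    m = at ms

  same-reflects : ∀ i k → Reflects (m i ≡ m k) (same i k)
  same-reflects i k = ≡ᵇ-reflects (m i) (m k)

  after-reflects : ∀ i k → Reflects (i < k × m i ≡ m k) ((i <ᵇ k) ∧ same i k)
  after-reflects i k = <ᵇ-reflects-< i k ×-reflects same-reflects i k

  next-spec : ∀ i → (∃ λ b → next i ≡ just b × Next i b) ⊎ (next i ≡ nothing × Last i)
  next-spec i with filterᵇ (λ j → (i <ᵇ j) ∧ same i j) els in eq
  ... | [] = inj₂ (refl , λ {k} i<k k<n e → contradiction
      (subst (k ∈_) eq (∈-filter-upTo⁺ k<n (reflects⇒T (after-reflects i k) (i<k , sym e)))) λ ())
  ... | b ∷ _ with b<n , pb , minb ← filter-upTo-head {n = n} eq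
              with i<b , e ← T⇒reflects (after-reflects i b) pb =
    inj₁ (b , refl , i<b , b<n , sym e ,
      λ {k} i<k k<b ek → minb k<b (reflects⇒T (after-reflects i k) (i<k , sym ek)))

  Next⇒¬Last : ∀ {i b} → Next i b → ¬ Last i
  Next⇒¬Last (i<b , b<n , e , _) last = last i<b b<n e

  isMax-reflects : ∀ i → Reflects (Last i) (isMax i)
  isMax-reflects i with next i | next-spec i
  ... | nothing | inj₂ (_ , last)       = ofʸ last
  ... | just b  | inj₁ (_ , refl , nxt) = ofⁿ (Next⇒¬Last nxt)

  nonmax-reflects : ∀ i → Reflects (¬ Last i) (not (isMax i))
  nonmax-reflects i = ¬-reflects (isMax-reflects i)

  nextℕ-spec : ∀ {i} → ¬ Last i → Next i (nextℕ i)
  nextℕ-spec {i} ¬last with next i | next-spec i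
  ... | nothing | inj₂ (_ , last)       = contradiction (λ {k} → last {k}) ¬last
  ... | just b  | inj₁ (_ , refl , nxt) = nxt

  edge-reflects : ∀ i b → Reflects (Next i b) (edge i b)
  edge-reflects i b with next i | next-spec i
  ... | nothing | inj₂ (_ , last)       = ofⁿ λ nxt → Next⇒¬Last nxt last
  ... | just c  | inj₁ (_ , refl , nxt) =
    reflects-map (λ { refl → nxt }) (λ nxt′ → Next-unique nxt nxt′) (≡ᵇ-reflects c b)

  inc4-reflects : ∀ i j k l → Reflects (i < j × j < k × k < l) (inc4 i j k l)
  inc4-reflects i j k l = <ᵇ-reflects-< i j ×-reflects (<ᵇ-reflects-< j k ×-reflects <ᵇ-reflects-< k l)

  maxOf-≥ : ∀ {k} xs → k ∈ xs → k ≤ maxOf xs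
  maxOf-≥ (x ∷ xs) k∈ with maxOf xs <ᵇ x | <ᵇ-reflects-< (maxOf xs) x
  maxOf-≥ (x ∷ xs) (here refl) | true  | ofʸ _ = ≤-refl
  maxOf-≥ (x ∷ xs) (there k∈)  | true  | ofʸ y<x = ≤-trans (maxOf-≥ xs k∈) (<⇒≤ y<x)
  maxOf-≥ (x ∷ xs) (here refl) | false | ofⁿ y≮x = ≮⇒≥ y≮x
  maxOf-≥ (x ∷ xs) (there k∈)  | false | ofⁿ _ = maxOf-≥ xs k∈

  -- maxOf [] is the junk value 0.
  maxOf-∈ : ∀ x xs → maxOf (x ∷ xs) ∈ x ∷ xs
  maxOf-∈ x xs with maxOf xs <ᵇ x | <ᵇ-reflects-< (maxOf xs) x
  maxOf-∈ x xs       | true  | _ = here refl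
  maxOf-∈ zero []    | false | _ = here refl
  maxOf-∈ (suc x) [] | false | ofⁿ 0≮ = contradiction z<s 0≮
  maxOf-∈ x (y ∷ ys) | false | _ = there (maxOf-∈ y ys)

  ∈-block⁺ : ∀ {i k} → k < n → m k ≡ m i → k ∈ block i
  ∈-block⁺ {i} {k} k<n e = ∈-filter-upTo⁺ k<n (reflects⇒T (same-reflects i k) (sym e))

  ∈-block⁻ : ∀ {i k} → k ∈ block i → k < n × m k ≡ m i
  ∈-block⁻ {i} {k} k∈ with k<n , t ← ∈-filter-upTo⁻ {n = n} k∈ =
    k<n , sym (T⇒reflects (same-reflects i k) t)

  bmax-spec : ∀ {i} → i < n → BlockMax i (bmax i)
  bmax-spec {i} i<n = proj₁ bmax∈ , proj₂ bmax∈ ,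
      λ b<k k<n e → <⇒≱ b<k (maxOf-≥ (block i) (∈-block⁺ k<n e))
    where
    inhabited : ∀ xs → i ∈ xs → maxOf xs ∈ xs
    inhabited (x ∷ xs) _ = maxOf-∈ x xs
    bmax∈ : bmax i < n × m (bmax i) ≡ m i
    bmax∈ = ∈-block⁻ (inhabited (block i) (∈-block⁺ i<n refl))

  bmax-cong : ∀ {i k} → i < n → k < n → m i ≡ m k → bmax i ≡ bmax k
  bmax-cong i<n k<n e = BlockMax-unique (BlockMax-cong e (bmax-spec i<n)) (bmax-spec k<n)

  bmax-injective : ∀ {i k} → i < n → k < n → bmax i ≡ bmax k → m i ≡ m k
  bmax-injective {i} {k} i<n k<n e with _ , ei , _ ← bmax-spec i<n | _ , ek , _ ← bmax-spec k<n =
    trans (sym ei) (trans (cong m e) ek)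

  ¬Last⇒<bmax : ∀ {i} → i < n → ¬ Last i → i < bmax i
  ¬Last⇒<bmax {i} i<n ¬last with b<n , e , maxb ← bmax-spec i<n =
    ≤∧≢⇒< (BlockMax-≥ (bmax-spec i<n) i<n refl) λ i≡b →
      ¬last (subst (λ b → ∀ {k} → b < k → k < n → m k ≢ m i) (sym i≡b) maxb)

  <bmax⇒¬Last : ∀ {i} → i < n → i < bmax i → ¬ Last i
  <bmax⇒¬Last i<n i<b last with b<n , e , _ ← bmax-spec i<n = last i<b b<n e

  module _ (valid : Valid) where

    isMin-reflects : ∀ {i} → i < n → Reflects (m i ≡ i) (isMin i)
    isMin-reflects {i} i<n = reflects-map to from (¬-reflects (any-reflects els λ k _ →
        <ᵇ-reflects-< k i ×-reflects same-reflects i k))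
      where
      to : ¬ (∃ λ k → k ∈ els × k < i × m i ≡ m k) → m i ≡ i
      to none with m≤i , idem ← valid i<n = ≤-antisym m≤i (≮⇒≥ λ m<i →
        none (m i , ∈-upTo⁺ (<-trans m<i i<n) , m<i , sym idem))
      from : m i ≡ i → ¬ (∃ λ k → k ∈ els × k < i × m i ≡ m k)
      from e (k , k∈ , k<i , ek) =
        <⇒≱ k<i (subst (_≤ k) (trans (sym ek) e) (proj₁ (valid (<-trans k<i i<n))))

    opener-reflects : ∀ {i} → i < n → Reflects (m i ≡ i × ¬ Last i) (opener i)
    opener-reflects {i} i<n =
      reflects-map to from (isMin-reflects i<n ×-reflects <ᵇ-reflects-< 1 (size i))
      where
      to : m i ≡ i × 1 < size i → m i ≡ i × ¬ Last i
      to (e , 1<) with k , k∈ , k≢i ← 1<length⇒∃≢ i (Unique.filter⁺ (T? ∘ same i) (Unique.upTo⁺ n)) 1<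
                  with k<n , ek ← ∈-block⁻ {i} k∈ =
        e , λ last → last (≤∧≢⇒< (subst (_≤ k) (trans ek e) (proj₁ (valid k<n))) (≢-sym k≢i)) k<n ek
      from : m i ≡ i × ¬ Last i → m i ≡ i × 1 < size i
      from (e , ¬last) with i<b , b<n , eb , _ ← nextℕ-spec ¬last =
        e , ∈²⇒1<length (block i) (∈-block⁺ i<n refl) (∈-block⁺ b<n eb) (<⇒≢ i<b)

    -- For an element that is neither minimum nor maximum of its block, the minimum, the element
    -- itself and its right neighbour are three distinct members, which gives the size required of
    -- an insider.
    active-reflects : ∀ {i} → i < n → Reflects (¬ Last i) (opener i ∨ insider i)
    active-reflects {i} i<n = reflects-map to from (opener-reflects i<n ⊎-reflects
        (<ᵇ-reflects-< 2 (size i) ×-reflects (¬-reflects (isMin-reflects i<n) ×-reflects nonmax-reflects i)))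
      where
      to : (m i ≡ i × ¬ Last i) ⊎ (2 < size i × m i ≢ i × ¬ Last i) → ¬ Last i
      to (inj₁ (_ , ¬last))     = ¬last
      to (inj₂ (_ , _ , ¬last)) = ¬last
      from : ¬ Last i → (m i ≡ i × ¬ Last i) ⊎ (2 < size i × m i ≢ i × ¬ Last i)
      from ¬last with m i ≟ i
      ... | yes e = inj₁ (e , ¬last)
      ... | no  e with i<b , b<n , eb , _ ← nextℕ-spec ¬last | m≤i , idem ← valid i<n =
        let m<i = ≤∧≢⇒< m≤i e in
        inj₂ (∈³⇒2<length (block i) (∈-block⁺ (<-trans m<i i<n) idem) (∈-block⁺ i<n refl) (∈-block⁺ b<n eb)
                (<⇒≢ m<i) (<⇒≢ (<-trans m<i i<b)) (<⇒≢ i<b) , e , ¬last)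

reflects-not : ∀ {P Q : Set} {a b} → Reflects P a → Reflects Q b → (P → ¬ Q) → (¬ P → Q) → Reflects P (not b)
reflects-not (ofʸ p)  (ofʸ q)  f g = contradiction q (f p)
reflects-not (ofʸ p)  (ofⁿ ¬q) f g = ofʸ p
reflects-not (ofⁿ ¬p) (ofʸ q)  f g = ofⁿ ¬p
reflects-not (ofⁿ ¬p) (ofⁿ ¬q) f g = contradiction (g ¬p) ¬q

reflects-∧ : ∀ {P Q : Set} {a b} → Reflects P a → (P → Reflects Q b) → Reflects (P × Q) (a ∧ b)
reflects-∧ (ofⁿ ¬p) r = ofⁿ (¬p ∘ proj₁)
reflects-∧ (ofʸ p)  r = reflects-map (p ,_) proj₂ (r p)

-- Local weights: the common form of the ten statistics

data Kind : Set where
  crossed nested dominated : Kind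

relᵇ : Kind → ℕ → ℕ → Bool
relᵇ crossed v w = v <ᵇ w
relᵇ _       v w = w <ᵇ v

Rel : Kind → ℕ → ℕ → Set
Rel crossed v w = v < w
Rel _       v w = w < v

Rel-reflects : ∀ κ v w → Reflects (Rel κ v w) (relᵇ κ v w)
Rel-reflects crossed   v w = <ᵇ-reflects-< v w
Rel-reflects nested    v w = <ᵇ-reflects-< w v
Rel-reflects dominated v w = <ᵇ-reflects-< w v

weight : Kind → ℕ → ℕ
weight dominated c = 1 ⊓ c
weight _         c = c

-- Scanning from right to left, the position x (subject to the guard g) attaches to the
-- open arc or block ending at u x; its competitors are the other ones open at x.
module Model (n : ℕ) (g src : ℕ → Bool) (u : ℕ → ℕ) where

  competitor : Kind → ℕ → ℕ → Bool
  competitor κ x i = (i <ᵇ x) ∧ src i ∧ (x <ᵇ u i) ∧ relᵇ κ (u i) (u x)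

  Competitor : Kind → ℕ → ℕ → Set
  Competitor κ x i = i < x × T (src i) × x < u i × Rel κ (u i) (u x)

  competitor-reflects : ∀ κ x i → Reflects (Competitor κ x i) (competitor κ x i)
  competitor-reflects κ x i = <ᵇ-reflects-< i x ×-reflects
    (T-reflects (src i) ×-reflects (<ᵇ-reflects-< x (u i) ×-reflects Rel-reflects κ (u i) (u x)))

  local : Kind → ℕ → ℕ
  local κ x = if g x then weight κ (countᵇ (competitor κ x) (upTo n)) else 0

  total : Kind → ℕ
  total κ = ∑ (upTo n) (local κ)

  ∃competitor-reflects : ∀ κ {x} → x < n → Reflects (∃ (Competitor κ x)) (any (competitor κ x) (upTo n))
  ∃competitor-reflects κ {x} x<n = reflects-map
    (λ { (i , _ , c) → i , c }) (λ { (i , c) → i , ∈-upTo⁺ (<-trans (proj₁ c) x<n) , c })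
    (any-reflects (upTo n) λ i _ → competitor-reflects κ x i)

  dominated-total : ∀ {p} → (∀ {x} → x < n → Reflects (T (g x) × ∃ (Competitor dominated x)) (p x)) →
                    countᵇ p (upTo n) ≡ total dominated
  dominated-total {p} r =
    trans (count-∑ p (upTo n)) (∑-cong (upTo n) λ x x∈ → pointwise x (∈-upTo⁻ x∈))
    where
    pointwise : ∀ x → x < n → 𝟙 (p x) ≡ local dominated x
    pointwise x x<n with g x | r x<n
    ... | false | rx = 𝟙-false proj₁ rx
    ... | true  | rx = sym (1⊓count (upTo n) (reflects-map
      (λ { (_ , i , c) → i , ∈-upTo⁺ (<-trans (proj₁ c) x<n) , reflects⇒T (competitor-reflects dominated x i) c })
      (λ { (i , _ , c) → _ , i , T⇒reflects (competitor-reflects dominated x i) c }) rx))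

  -- Interchanging the two sums charges each pair to its larger member `x`, the one that carries the
  -- guard. The condition on `weight` admits `crossed` and `nested` but not `dominated`, which only
  -- records whether a competitor exists.
  pairs-total : ∀ κ → (∀ c → weight κ c ≡ c) → (f : ℕ → ℕ → ℕ) →
                (∀ {i x} → i < n → x < n → f i x ≡ 𝟙 (g x ∧ competitor κ x i)) →
                ∑ (upTo n) (λ i → ∑ (upTo n) (f i)) ≡ total κ
  pairs-total κ w≡ f f≡ = begin
    ∑ els (λ i → ∑ els (f i))                            ≡⟨ ∑-swap els els f ⟩
    ∑ els (λ x → ∑ els λ i → f i x)                      ≡⟨ ∑-cong els (λ x x∈ → begin
      ∑ els (λ i → f i x)                                  ≡⟨ ∑-cong els (λ i i∈ → f≡ (∈-upTo⁻ i∈) (∈-upTo⁻ x∈)) ⟩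
      ∑ els (λ i → 𝟙 (g x ∧ competitor κ x i))             ≡⟨ ∑-if (g x) els (competitor κ x) ⟨
      (if g x then countᵇ (competitor κ x) els else 0)     ≡⟨ cong (λ c → if g x then c else 0) (w≡ _) ⟨
      local κ x                                            ∎) ⟩
    total κ                                              ∎
    where
    open ≡-Reasoning
    els = upTo n

-- A kind, a guard and a level together determine a statistic. Ten of the twelve combinations occur
-- here; the sign argument treats all of them uniformly.
kind : Statistic → Kind
kind nonExclRec        = dominated
kind nonExclRecOpener  = dominated
kind crossing          = crossed
kind nesting           = nested
kind openerCrossing    = crossed
kind openerNesting     = nested
kind nonBlockRec       = dominated
kind nonBlockRecOpener = dominated
kind overlapping       = crossed
kind covering          = nested

data Guard : Set where
  allActive openers : Guard

guardOf : Statistic → Guard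
guardOf nonExclRec  = allActive
guardOf crossing    = allActive
guardOf nesting     = allActive
guardOf nonBlockRec = allActive
guardOf _           = openers

data Level : Set where
  arcs blocks : Level

levelOf : Statistic → Level
levelOf nonBlockRec       = blocks
levelOf nonBlockRecOpener = blocks
levelOf overlapping       = blocks
levelOf covering          = blocks
levelOf _                 = arcs

-- Identifying each statistic with a sum of local weights

module Encoding (n : ℕ) (ms : List ℕ) where
  open Structure n ms
  open Word n (at ms)
  open Facts n ms

  private
    m : ℕ → ℕ
    m = at ms

  guard : Guard → ℕ → Bool
  guard allActive x = not (isMax x)
  guard openers   x = opener x

  source : Level → ℕ → Bool
  source arcs   x = not (isMax x)
  source blocks x = isMin x

  target : Level → ℕ → ℕ
  target arcs   = nextℕ
  target blocks = bmax

  module _ (valid : Valid) where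

    guard⇒¬Last : ∀ γ {x} → x < n → T (guard γ x) → ¬ Last x
    guard⇒¬Last allActive {x} _ t = T⇒reflects (nonmax-reflects x) t
    guard⇒¬Last openers   x<n t = proj₂ (T⇒reflects (opener-reflects valid x<n) t)

    private
      module M (γ : Guard) (ℓ : Level) = Model n (guard γ) (source ℓ) (target ℓ)

      ¬Last⇒T : ∀ {i} → ¬ Last i → T (not (isMax i))
      ¬Last⇒T {i} = reflects⇒T (nonmax-reflects i)

      T⇒¬Last : ∀ {i} → T (not (isMax i)) → ¬ Last i
      T⇒¬Last {i} = T⇒reflects (nonmax-reflects i)

    -- Distinct arcs have distinct right ends, so failing to exceed all earlier right neighbours
    -- means that some earlier arc ends strictly later. Such an arc is open at `x`, because `x` lies
    -- before its own right neighbour.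
    nonExclusive-reflects : ∀ γ {x} → x < n →
      Reflects (T (guard γ x) × ∃ (M.Competitor γ arcs dominated x)) (guard γ x ∧ not (exclusiveRecord x))
    nonExclusive-reflects γ {x} x<n =
      reflects-∧ (T-reflects (guard γ x)) λ t →
        reflects-not (M.∃competitor-reflects γ arcs dominated x<n)
          (nonmax-reflects x ×-reflects all-reflects els λ j _ →
            ¬-reflects (<ᵇ-reflects-< j x ×-reflects nonmax-reflects j) ⊎-reflects
            <ᵇ-reflects-< (nextℕ j) (nextℕ x))
          overtaken (exclusive (guard⇒¬Last γ x<n t))
      where
      Exclusive : Set
      Exclusive = ¬ Last x × ∀ j → j ∈ els → ¬ (j < x × ¬ Last j) ⊎ nextℕ j < nextℕ x
      overtaken : ∃ (M.Competitor γ arcs dominated x) → ¬ Exclusive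
      overtaken (i , i<x , ti , _ , x<i) (_ , excl) with excl i (∈-upTo⁺ (<-trans i<x x<n))
      ... | inj₁ none = none (i<x , T⇒¬Last ti)
      ... | inj₂ i<x′ = <-asym i<x′ x<i
      exclusive : ¬ Last x → ¬ ∃ (M.Competitor γ arcs dominated x) → Exclusive
      exclusive ¬last none = ¬last , smaller
        where
        smaller : ∀ j → j ∈ els → ¬ (j < x × ¬ Last j) ⊎ nextℕ j < nextℕ x
        smaller j _ with (j <ᵇ x) ∧ not (isMax j) | <ᵇ-reflects-< j x ×-reflects nonmax-reflects j
        ... | false | ofⁿ ¬c = inj₁ ¬c
        ... | true  | ofʸ (j<x , ¬lastj) with <-cmp (nextℕ j) (nextℕ x)
        ...   | tri< lt _ _ = inj₂ lt
        ...   | tri≈ _ eq _ = contradiction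
          (Next-injective (nextℕ-spec ¬lastj) (subst (Next x) (sym eq) (nextℕ-spec ¬last))) (<⇒≢ j<x)
        ...   | tri> _ _ gt = contradiction
          (j , j<x , ¬Last⇒T ¬lastj , <-trans (proj₁ (nextℕ-spec ¬last)) gt , gt) none

    -- Blocks with equal maxima coincide, which settles ties. An earlier element whose block reaches
    -- further than that of `x` is replaced by the minimum of its block, since sources at block
    -- level are minima.
    nonBlockRecord-reflects : ∀ γ {x b} → x < n → Reflects (T (guard γ x)) b →
      Reflects (T (guard γ x) × ∃ (M.Competitor γ blocks dominated x)) (b ∧ not (blockRecord x))
    nonBlockRecord-reflects γ {x} x<n r =
      reflects-∧ r λ t → reflects-not (M.∃competitor-reflects γ blocks dominated x<n)
        (active-reflects valid x<n ×-reflects all-reflects els λ i _ →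
          ¬-reflects (<ᵇ-reflects-< i x) ⊎-reflects
          (same-reflects i x ⊎-reflects <ᵇ-reflects-< (bmax i) (bmax x)))
        overtaken (maximal (guard⇒¬Last γ x<n t))
      where
      Maximal : Set
      Maximal = ¬ Last x × ∀ i → i ∈ els → ¬ i < x ⊎ m i ≡ m x ⊎ bmax i < bmax x
      overtaken : ∃ (M.Competitor γ blocks dominated x) → ¬ Maximal
      overtaken (i , i<x , _ , _ , x<i) (_ , rec) with rec i (∈-upTo⁺ (<-trans i<x x<n))
      ... | inj₁ i≮x         = i≮x i<x
      ... | inj₂ (inj₁ same) = <⇒≢ x<i (sym (bmax-cong (<-trans i<x x<n) x<n same))
      ... | inj₂ (inj₂ i<x′) = <-asym i<x′ x<i
      maximal : ¬ Last x → ¬ ∃ (M.Competitor γ blocks dominated x) → Maximal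
      maximal ¬last none = ¬last , smaller
        where
        smaller : ∀ i → i ∈ els → ¬ i < x ⊎ m i ≡ m x ⊎ bmax i < bmax x
        smaller i i∈ with i <? x | <-cmp (bmax i) (bmax x)
        ... | no i≮x  | _           = inj₁ i≮x
        ... | yes i<x | tri< lt _ _ = inj₂ (inj₂ lt)
        ... | yes i<x | tri≈ _ eq _ = inj₂ (inj₁ (bmax-injective (<-trans i<x x<n) x<n eq))
        ... | yes i<x | tri> _ _ gt with m≤i , idem ← valid (<-trans i<x x<n) =
          let i<n = <-trans i<x x<n
              min<n = ≤-<-trans m≤i i<n
              gt′ = subst (bmax x <_) (bmax-cong i<n min<n (sym idem)) gt
          in contradiction (m i , ≤-<-trans m≤i i<x , reflects⇒T (isMin-reflects valid min<n) idem ,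
                            <-trans (¬Last⇒<bmax x<n ¬last) gt′ , gt′) none

    -- Once `i` and `j` are fixed, `k` and `l` can only be their right neighbours, so the sum over
    -- `k` and `l` is 0 or 1 and the crossing is charged to `j`.
    crossings-total : ∀ γ p → (∀ {i j k l} → j < n → Reflects
      ((i < j × j < k × k < l) × Next i k × Next j l × T (guard γ j)) (p i j k l)) →
      count4 p ≡ M.total γ arcs crossed
    crossings-total γ p r = M.pairs-total γ arcs crossed (λ _ → refl) _ λ {i} {j} i<n j<n →
      ∑∑-point (Unique.upTo⁺ n) (λ k l → r {i} {j} {k} {l} j<n)
        (λ { (_ , ik , jl , _) (_ , ik′ , jl′ , _) → Next-unique ik ik′ , Next-unique jl jl′ })
        (reflects-map
          (λ { (tj , i<j , ti , j<k , k<l) →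
               let ik = nextℕ-spec (T⇒¬Last ti)
                   jl = nextℕ-spec (guard⇒¬Last γ j<n tj)
               in _ , _ , ∈-upTo⁺ (proj₁ (proj₂ ik)) , ∈-upTo⁺ (proj₁ (proj₂ jl)) ,
                  (i<j , j<k , k<l) , ik , jl , tj })
          (λ { (k , l , _ , _ , (i<j , j<k , k<l) , ik , jl , tj) →
               let ti = Next⇒¬Last ik
                   k≡ = Next-unique ik (nextℕ-spec ti)
                   l≡ = Next-unique jl (nextℕ-spec (Next⇒¬Last jl))
               in tj , i<j , ¬Last⇒T ti , subst (j <_) k≡ j<k , subst₂ _<_ k≡ l≡ k<l })
          (T-reflects (guard γ j) ×-reflects M.competitor-reflects γ arcs crossed j i))

    nestings-total : ∀ γ p → (∀ {i j k l} → j < n → Reflects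
      ((i < j × j < k × k < l) × Next i l × Next j k × T (guard γ j)) (p i j k l)) →
      count4 p ≡ M.total γ arcs nested
    nestings-total γ p r = M.pairs-total γ arcs nested (λ _ → refl) _ λ {i} {j} i<n j<n →
      ∑∑-point (Unique.upTo⁺ n) (λ k l → r {i} {j} {k} {l} j<n)
        (λ { (_ , il , jk , _) (_ , il′ , jk′ , _) → Next-unique jk jk′ , Next-unique il il′ })
        (reflects-map
          (λ { (tj , i<j , ti , j<l , k<l) →
               let il = nextℕ-spec (T⇒¬Last ti)
                   jk = nextℕ-spec (guard⇒¬Last γ j<n tj)
               in _ , _ , ∈-upTo⁺ (proj₁ (proj₂ jk)) , ∈-upTo⁺ (proj₁ (proj₂ il)) ,
                  (i<j , proj₁ jk , k<l) , il , jk , tj })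
          (λ { (k , l , _ , _ , (i<j , j<k , k<l) , il , jk , tj) →
               let ti = Next⇒¬Last il
                   l≡ = Next-unique il (nextℕ-spec ti)
                   k≡ = Next-unique jk (nextℕ-spec (Next⇒¬Last jk))
               in tj , i<j , ¬Last⇒T ti , subst (j <_) l≡ (<-trans j<k k<l) , subst₂ _<_ k≡ l≡ k<l })
          (T-reflects (guard γ j) ×-reflects M.competitor-reflects γ arcs nested j i))

    -- A block minimum `b` with `b < bmax b` is exactly an opener, which is how a condition on pairs
    -- of blocks acquires the guard `openers`. Overlaps imply this inequality and coverings state
    -- it.
    blockPairs-total : ∀ κ → (∀ c → weight κ c ≡ c) → ∀ p →
      (∀ {a b} → a < n → b < n → Reflects (a < b × (b < bmax a × Rel κ (bmax a) (bmax b)) × b < bmax b) (p a b)) →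
      count2 mins p ≡ M.total openers blocks κ
    blockPairs-total κ w≡ p r = begin
      ∑ mins (λ a → countᵇ (p a) mins)                                  ≡⟨ ∑-filter isMin els _ ⟩
      ∑ els (λ a → if isMin a then countᵇ (p a) mins else 0)            ≡⟨ ∑-cong els (λ a _ → restrict (isMin a) (p a)) ⟩
      ∑ els (λ a → ∑ els λ b → 𝟙 (isMin a ∧ isMin b ∧ p a b))          ≡⟨ M.pairs-total openers blocks κ w≡ _ (λ {a} {b} a<n b<n →
        cong 𝟙 (reflects⇒≡
          (T-reflects (isMin a) ×-reflects (isMin-reflects valid b<n ×-reflects r a<n b<n))
          (opener-reflects valid b<n ×-reflects M.competitor-reflects openers blocks κ b a)
          (λ { (ta , mb , a<b , (b<a , rel) , b<b) → (mb , <bmax⇒¬Last b<n b<b) , a<b , ta , b<a , rel })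
          (λ { ((mb , ¬last) , a<b , ta , b<a , rel) → ta , mb , a<b , (b<a , rel) , ¬Last⇒<bmax b<n ¬last }))) ⟩
      M.total openers blocks κ                                          ∎
      where
      open ≡-Reasoning
      if-∧ : ∀ b c → (if b then 𝟙 c else 0) ≡ 𝟙 (b ∧ c)
      if-∧ true  c = refl
      if-∧ false c = refl
      restrict : ∀ c q → (if c then countᵇ q mins else 0) ≡ ∑ els λ b → 𝟙 (c ∧ isMin b ∧ q b)
      restrict false q = sym (∑-zero els λ _ _ → refl)
      restrict true  q = trans (count-∑ q mins) (trans (∑-filter isMin els _) (∑-cong els λ b _ → if-∧ (isMin b) (q b)))

word : ∀ {n} → Π n → ℕ → ℕ
word π = at (toList (vec π))

validL-reflects : ∀ n ms → Reflects (Word.Valid n (at ms)) (validL n ms)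
validL-reflects n ms = reflects-map (λ h i<n → h _ (∈-upTo⁺ i<n)) (λ h i i∈ → h (∈-upTo⁻ i∈))
  (all-reflects (upTo n) λ i _ → ≤ᵇ-reflects-≤ (at ms i) i ×-reflects ≡ᵇ-reflects (at ms (at ms i)) (at ms i))

word-valid : ∀ {n} (π : Π n) → Word.Valid n (word π)
word-valid {n} π = T⇒reflects (validL-reflects n (toList (vec π))) (valid π)

modelStat : Statistic → ∀ n → List ℕ → ℕ
modelStat s n ms = Model.total n (guard (guardOf s)) (source (levelOf s)) (target (levelOf s)) (kind s)
  where open Encoding n ms

stat-model : ∀ s {n} (π : Π n) → stat s π ≡ modelStat s n (toList (vec π))
stat-model s {n} π = go s
  where
  ms = toList (vec π)
  open Structure n ms
  open Word n (at ms)
  open Facts n ms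
  open Encoding n ms
  ok : Valid
  ok = word-valid π
  nonmax : ∀ {j l} → Next j l → T (not (isMax j))
  nonmax {j} nxt = reflects⇒T (nonmax-reflects j) (Next⇒¬Last nxt)
  go : ∀ s → stat s π ≡ modelStat s n ms
  go nonExclRec        = Model.dominated-total _ _ _ _ (nonExclusive-reflects ok allActive)
  go nonExclRecOpener  = Model.dominated-total _ _ _ _ (nonExclusive-reflects ok openers)
  go crossing          = crossings-total ok allActive _ λ {i} {j} {k} {l} _ → reflects-map
    (λ { (inc , ik , jl) → inc , ik , jl , nonmax jl }) (λ { (inc , ik , jl , _) → inc , ik , jl })
    (inc4-reflects i j k l ×-reflects (edge-reflects i k ×-reflects edge-reflects j l))
  go nesting           = nestings-total ok allActive _ λ {i} {j} {k} {l} _ → reflects-map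
    (λ { (inc , il , jk) → inc , il , jk , nonmax jk }) (λ { (inc , il , jk , _) → inc , il , jk })
    (inc4-reflects i j k l ×-reflects (edge-reflects i l ×-reflects edge-reflects j k))
  go openerCrossing    = crossings-total ok openers _ λ {i} {j} {k} {l} _ →
    inc4-reflects i j k l ×-reflects
      (edge-reflects i k ×-reflects (edge-reflects j l ×-reflects T-reflects (opener j)))
  go openerNesting     = nestings-total ok openers _ λ {i} {j} {k} {l} _ →
    inc4-reflects i j k l ×-reflects
      (edge-reflects i l ×-reflects (edge-reflects j k ×-reflects T-reflects (opener j)))
  go nonBlockRec       = Model.dominated-total _ _ _ _ λ {x} x<n → nonBlockRecord-reflects ok allActive x<n
    (reflects-map (reflects⇒T (nonmax-reflects x)) (T⇒reflects (nonmax-reflects x)) (active-reflects ok x<n))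
  go nonBlockRecOpener = Model.dominated-total _ _ _ _ λ x<n →
    nonBlockRecord-reflects ok openers x<n (T-reflects _)
  go overlapping       = blockPairs-total ok crossed (λ _ → refl) _ λ {a} {b} a<n b<n → reflects-map
    (λ { (a<b , b<a , lt) → a<b , (b<a , lt) , <-trans b<a lt }) (λ { (a<b , (b<a , lt) , _) → a<b , b<a , lt })
    (<ᵇ-reflects-< a b ×-reflects (<ᵇ-reflects-< b (bmax a) ×-reflects <ᵇ-reflects-< (bmax a) (bmax b)))
  go covering          = blockPairs-total ok nested (λ _ → refl) _ λ {a} {b} a<n b<n → reflects-map
    (λ { (a<b , b<b , lt) → a<b , (<-trans b<b lt , lt) , b<b }) (λ { (a<b , (_ , lt) , b<b) → a<b , b<b , lt })
    (<ᵇ-reflects-< a b ×-reflects (<ᵇ-reflects-< b (bmax b) ×-reflects <ᵇ-reflects-< (bmax b) (bmax a)))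

-- Exchanging the labels j and a after position j

transpose : ℕ → ℕ → ℕ → ℕ
transpose j a x with x ≟ j | x ≟ a
... | yes _ | _     = a
... | no _  | yes _ = j
... | no _  | no _  = x

transpose-left : ∀ j a → transpose j a j ≡ a
transpose-left j a with j ≟ j | j ≟ a
... | yes _  | _ = refl
... | no j≢j | _ = contradiction refl j≢j

transpose-right : ∀ j a → transpose j a a ≡ j
transpose-right j a with a ≟ j | a ≟ a
... | yes a≡j | _      = a≡j
... | no _    | yes _  = refl
... | no _    | no a≢a = contradiction refl a≢a

transpose-other : ∀ {j a x} → x ≢ j → x ≢ a → transpose j a x ≡ x
transpose-other {j} {a} {x} x≢j x≢a with x ≟ j | x ≟ a
... | yes x≡j | _       = contradiction x≡j x≢j
... | no _    | yes x≡a = contradiction x≡a x≢a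
... | no _    | no _    = refl

data TransposeView (j a : ℕ) : ℕ → ℕ → Set where
  left  : TransposeView j a j a
  right : TransposeView j a a j
  other : ∀ {x} → x ≢ j → x ≢ a → TransposeView j a x x

transposeView : ∀ j a x → TransposeView j a x (transpose j a x)
transposeView j a x with x ≟ j | x ≟ a
... | yes refl | _        = left
... | no _     | yes refl = right
... | no x≢j   | no x≢a   = other x≢j x≢a

transpose-involutive : ∀ j a x → transpose j a (transpose j a x) ≡ x
transpose-involutive j a x with transpose j a x | transposeView j a x
... | _ | left          = transpose-right j a
... | _ | right         = transpose-left j a
... | _ | other x≢j x≢a = transpose-other x≢j x≢a

transpose-< : ∀ {j a x b} → j < b → a < b → x < b → transpose j a x < b
transpose-< {j} {a} {x} j<b a<b x<b with transpose j a x | transposeView j a x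
... | _ | left      = a<b
... | _ | right     = j<b
... | _ | other _ _ = x<b

transpose-injective : ∀ j a {x y} → transpose j a x ≡ transpose j a y → x ≡ y
transpose-injective j a {x} {y} e =
  trans (sym (transpose-involutive j a x)) (trans (cong (transpose j a) e) (transpose-involutive j a y))

-- Effect of one switch on a total weight

Adjacent : ℕ → ℕ → Set
Adjacent k l = l ≡ suc k ⊎ k ≡ suc l

Rel-irrefl : ∀ κ {v w} → v ≡ w → ¬ Rel κ v w
Rel-irrefl crossed   refl = <-irrefl refl
Rel-irrefl nested    refl = <-irrefl refl
Rel-irrefl dominated refl = <-irrefl refl

-- Both words offer the same two ends at the switched position, with their roles interchanged.
-- Distinct ends are ordered in one way only, so one of the two weights is 1 and the other 0.
Adjacent-𝟙 : ∀ κ {v w} → v ≢ w → ∀ r → Adjacent (𝟙 (relᵇ κ v w) + r) (𝟙 (relᵇ κ w v) + r)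
Adjacent-𝟙 crossed {v} {w} v≢w r with v <ᵇ w | w <ᵇ v | <ᵇ-reflects-< v w | <ᵇ-reflects-< w v
... | true  | false | _        | _        = inj₂ refl
... | false | true  | _        | _        = inj₁ refl
... | true  | true  | ofʸ v<w  | ofʸ w<v  = contradiction w<v (<-asym v<w)
... | false | false | ofⁿ v≮w  | ofⁿ w≮v  = contradiction (≤-antisym (≮⇒≥ w≮v) (≮⇒≥ v≮w)) v≢w
Adjacent-𝟙 nested    v≢w r = Adjacent-𝟙 crossed (≢-sym v≢w) r
Adjacent-𝟙 dominated v≢w r = Adjacent-𝟙 crossed (≢-sym v≢w) r

-- The conclusion is equality of ends rather than absence of open sources: at block level the block
-- of an insider `x` is itself open at `x`. Equal ends are enough, since `Rel` is irreflexive.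
Flat : (g src : ℕ → Bool) (u : ℕ → ℕ) → ℕ → Set
Flat g src u j = ∀ {x i} → x < j → T (g x) → i < x → T (src i) → x < u i → u i ≡ u x

module _ {n : ℕ} {g src : ℕ → Bool} {u : ℕ → ℕ} where
  open Model n g src u

  flat-local : ∀ κ {j x} → Flat g src u j → x < j → local κ x ≡ 0
  flat-local κ {j} {x} flat x<j = go (g x) refl
    where
    weight-zero : ∀ κ → weight κ 0 ≡ 0
    weight-zero crossed   = refl
    weight-zero nested    = refl
    weight-zero dominated = refl
    go : ∀ b → g x ≡ b → (if b then weight κ (countᵇ (competitor κ x) (upTo n)) else 0) ≡ 0
    go false _  = refl
    go true  gx = trans (cong (weight κ) (count-zero (upTo n) (λ i _ → competitor-reflects κ x i)
      λ { i _ (i<x , si , x<ui , rel) →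
          Rel-irrefl κ (flat x<j (subst T (sym gx) _) i<x si x<ui) rel })) (weight-zero κ)

  flat-total : ∀ κ → Flat g src u n → total κ ≡ 0
  flat-total κ flat = ∑-zero (upTo n) λ x x∈ → flat-local κ flat (∈-upTo⁻ x∈)

  -- With a single candidate the count is 0 or 1, where the truncation `1 ⊓ c` changes nothing;
  -- hence all three kinds reduce to one comparison of ends.
  unique-competitor-local : ∀ κ {j q} → j < n → q < j → T (g j) → T (src q) → j < u q →
    (∀ {i} → i < j → T (src i) → j < u i → i ≡ q) → local κ j ≡ 𝟙 (relᵇ κ (u q) (u j))
  unique-competitor-local κ {j} {q} j<n q<j gj sq j<uq only = begin
    local κ j                                        ≡⟨ unguard (g j) gj ⟩
    weight κ (countᵇ (competitor κ j) (upTo n))      ≡⟨ cong (weight κ) (count-point (Unique.upTo⁺ n)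
      (λ i _ → competitor-reflects κ j i) (∈-upTo⁺ (<-trans q<j j<n))
      (λ { i _ (i<j , si , j<ui , _) → only i<j si j<ui })) ⟩
    weight κ (𝟙 (competitor κ j q))                  ≡⟨ weight-𝟙 κ (competitor κ j q) ⟩
    𝟙 (competitor κ j q)                             ≡⟨ cong 𝟙 (reflects⇒≡ (competitor-reflects κ j q)
      (Rel-reflects κ (u q) (u j)) (λ { (_ , _ , _ , rel) → rel }) (λ rel → q<j , sq , j<uq , rel)) ⟩
    𝟙 (relᵇ κ (u q) (u j))                           ∎
    where
    open ≡-Reasoning
    unguard : ∀ b {c} → T b → (if b then c else 0) ≡ c
    unguard true _ = refl
    weight-𝟙 : ∀ κ b → weight κ (𝟙 b) ≡ 𝟙 b
    weight-𝟙 crossed   b     = refl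
    weight-𝟙 nested    b     = refl
    weight-𝟙 dominated true  = refl
    weight-𝟙 dominated false = refl

-- The interface between words and weights: all that the sign argument has to know about the
-- exchange. Here `q` is the start of the one arc or block open at `j`.
record Switch (n j q : ℕ) (g g′ src src′ : ℕ → Bool) (u u′ : ℕ → ℕ) : Set where
  field
    q<j    : q < j
    j<n    : j < n
    gj     : T (g j)
    srcj   : T (src j)
    srcq   : T (src q)
    g′≡g   : ∀ {x} → x < n → g′ x ≡ g x
    s′≡s   : ∀ {i} → i < n → src′ i ≡ src i
    -- Ends follow the transposition only at sources. At block level, an element of the block of `q`
    -- strictly between `q` and `j` also changes its maximum although the transposition fixes it;
    -- positions after `j` are covered by `u′-hi`.
    u′-src : ∀ {i} → i < n → T (src i) → u′ i ≡ u (transpose j q i)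
    u′-hi  : ∀ {x} → j < x → x < n → T (g x) → u′ x ≡ u x
    j<uj   : j < u j
    j<uq   : j < u q
    uj≢uq  : u j ≢ u q
    only   : ∀ {i} → i < j → T (src i) → j < u i → i ≡ q
    flat   : Flat g src u j
    flat′  : Flat g′ src′ u′ j

module _ {n j q : ℕ} {g g′ src src′ : ℕ → Bool} {u u′ : ℕ → ℕ} (sw : Switch n j q g g′ src src′ u u′) where
  open Switch sw
  private
    module M  = Model n g src u
    module M′ = Model n g′ src′ u′

    q<n : q < n
    q<n = <-trans q<j j<n

    τ : ℕ → ℕ
    τ = transpose j q

    τ-< : ∀ {b i} → j < b → i < b → τ i < b
    τ-< j<b i<b = transpose-< j<b (<-trans q<j j<b) i<b

    τ-src : ∀ {i} → T (src i) → T (src (τ i))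
    τ-src {i} si with τ i | transposeView j q i
    ... | _ | left      = srcq
    ... | _ | right     = srcj
    ... | _ | other _ _ = si

    u′j : u′ j ≡ u q
    u′j = trans (u′-src j<n srcj) (cong u (transpose-left j q))

    u′q : u′ q ≡ u j
    u′q = trans (u′-src q<n srcq) (cong u (transpose-right j q))

    only′ : ∀ {i} → i < j → T (src′ i) → j < u′ i → i ≡ q
    only′ {i} i<j si′ j<u′ with i ≟ q
    ... | yes i≡q = i≡q
    ... | no  i≢q = only i<j si (subst (j <_) (trans (u′-src (<-trans i<j j<n) si)
                      (cong u (transpose-other (<⇒≢ i<j) i≢q))) j<u′)
      where si = subst T (s′≡s (<-trans i<j j<n)) si′

    switch-competitor : ∀ κ {x} → j < x → x < n → T (g x) → ∀ i → i < n →
                        M′.competitor κ x i ≡ M.competitor κ x (τ i)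
    switch-competitor κ {x} j<x x<n gx i i<n = reflects⇒≡
      (M′.competitor-reflects κ x i) (M.competitor-reflects κ x (τ i))
      (λ { (i<x , si′ , x<u′ , rel) → let si = subst T (s′≡s i<n) si′ in
           τ-< j<x i<x , τ-src si , subst (x <_) (u′-src i<n si) x<u′ , subst₂ (Rel κ) (u′-src i<n si) ux rel })
      (λ { (τi<x , sτi , x<u , rel) →
           let si = subst (T ∘ src) (transpose-involutive j q i) (τ-src sτi)
               e  = sym (u′-src i<n si)
           in subst (_< x) (transpose-involutive j q i) (τ-< j<x τi<x) , subst T (sym (s′≡s i<n)) si ,
              subst (x <_) e x<u , subst₂ (Rel κ) e (sym ux) rel })
      where
      ux : u′ x ≡ u x
      ux = u′-hi j<x x<n gx

    -- For `x` beyond both `j` and `q`, the transposition maps the positions below `x` to themselves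
    -- and carries ends along, so the competitors of `x` are merely permuted.
    switch-count : ∀ κ {x} → j < x → x < n → T (g x) →
                   countᵇ (M′.competitor κ x) (upTo n) ≡ countᵇ (M.competitor κ x) (upTo n)
    switch-count κ {x} j<x x<n gx = begin
      countᵇ (M′.competitor κ x) els           ≡⟨ count-∑ _ els ⟩
      ∑ els (𝟙 ∘ M′.competitor κ x)            ≡⟨ ∑-cong els (λ i i∈ → cong 𝟙 (switch-competitor κ j<x x<n gx i (∈-upTo⁻ i∈))) ⟩
      ∑ els (𝟙 ∘ M.competitor κ x ∘ τ)         ≡⟨ ∑-map τ els _ ⟨
      ∑ (map τ els) (𝟙 ∘ M.competitor κ x)     ≡⟨ sum-↭ (map⁺ _ (involution-↭ (Unique.upTo⁺ n)
        (λ i i∈ → ∈-upTo⁺ (τ-< j<n (∈-upTo⁻ i∈))) (transpose-involutive j q))) ⟩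
      ∑ els (𝟙 ∘ M.competitor κ x)             ≡⟨ count-∑ _ els ⟨
      countᵇ (M.competitor κ x) els            ∎
      where
      open ≡-Reasoning
      els = upTo n

    switch-local : ∀ κ x → x ∈ upTo n → x ≢ j → M.local κ x ≡ M′.local κ x
    switch-local κ x x∈ x≢j with <-cmp x j
    ... | tri< x<j _ _ = trans (flat-local {n} κ flat x<j) (sym (flat-local {n} κ flat′ x<j))
    ... | tri≈ _ x≡j _ = contradiction x≡j x≢j
    ... | tri> _ _ j<x = trans (go (g x) refl) (cong (λ b → if b then _ else 0) (sym (g′≡g (∈-upTo⁻ x∈))))
      where
      go : ∀ b → g x ≡ b → (if b then weight κ (countᵇ (M.competitor κ x) (upTo n)) else 0) ≡
                           (if b then weight κ (countᵇ (M′.competitor κ x) (upTo n)) else 0)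
      go false _  = refl
      go true  gx = cong (weight κ) (sym (switch-count κ j<x (∈-upTo⁻ x∈) (subst T (sym gx) _)))

  -- All weights other than the one at `j` go into the common remainder. At `j` the only candidate
  -- is `q` in both models, and the ends of `q` and `j` have traded places.
  switch-total : ∀ κ → Adjacent (M.total κ) (M′.total κ)
  switch-total κ with r , e , e′ ← ∑-common (M.local κ) (M′.local κ) (Unique.upTo⁺ n) (∈-upTo⁺ j<n) (switch-local κ) =
    subst₂ Adjacent
      (sym (trans e (cong (_+ r) (unique-competitor-local {g = g} κ j<n q<j gj srcq j<uq only))))
      (sym (trans e′ (cong (_+ r) (trans
        (unique-competitor-local {g = g′} κ j<n q<j (subst T (sym (g′≡g j<n)) gj) (subst T (sym (s′≡s q<n)) srcq)
          (subst (j <_) (sym u′q) j<uj) only′)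
        (cong₂ (λ v w → 𝟙 (relᵇ κ v w)) u′q u′j)))))
      (Adjacent-𝟙 κ (≢-sym uj≢uq) r)

-- The least bad opener and the block that spans it

module Labels (n : ℕ) (m : ℕ → ℕ) where
  open Word n m

  -- A block opens at x strictly inside the span of another block.
  Bad : ℕ → Set
  Bad x = m x ≡ x × (∃ λ y → y < n × x < y × m y ≡ x) × (∃ λ y → y < n × x < y × m y < x)

  record Pair (j a : ℕ) : Set where
    field
      j<n     : j < n
      a<j     : a < j
      mj      : m j ≡ j
      after-j : ∃ λ y → y < n × j < y × m y ≡ j
      after-a : ∃ λ y → y < n × j < y × m y ≡ a
      least   : ∀ {x} → x < j → ¬ Bad x

    a<n : a < n
    a<n = <-trans a<j j<n

    bad-j : Bad j
    bad-j with y , y<n , j<y , my ← after-a = mj , after-j , y , y<n , j<y , subst (_< j) (sym my) a<j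

  module _ (valid : Valid) where

    -- If the blocks of `i` and `x` were different, the larger of their minima would be a bad opener
    -- before `j`: its own block continues after it, and the other block still has a member later
    -- on.
    spanned⇒same : ∀ {j x i y} → j ≤ n → (∀ {x} → x < j → ¬ Bad x) → x < j → ¬ Last x →
                   i < x → x < y → y < n → m y ≡ m i → m i ≡ m x
    spanned⇒same {j} {x} {i} {y} j≤n ok x<j ¬last i<x x<y y<n e
      with x<n ← <-≤-trans x<j j≤n
      with mi≤i , idi ← valid (<-trans i<x x<n) | mx≤x , idx ← valid x<n | <-cmp (m i) (m x)
    ... | tri≈ _ same _ = same
    ... | tri> _ _ mx<mi = contradiction
      (idi , (y , y<n , ≤-<-trans mi≤i (<-trans i<x x<y) , e) , x , x<n , ≤-<-trans mi≤i i<x , mx<mi)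
      (ok (≤-<-trans mi≤i (<-trans i<x x<j)))
    ... | tri< mi<mx _ _ = ⊥-elim (¬last λ {z} x<z z<n ez → ok (≤-<-trans mx≤x x<j)
      (idx , (z , z<n , ≤-<-trans mx≤x x<z , ez) , y , y<n , ≤-<-trans mx≤x x<y , subst (_< m x) (sym e) mi<mx))

    -- Of two distinct labels below `j` that both occur after `j`, the larger opens inside the span
    -- of the smaller, so it would be bad.
    open-label-unique : ∀ {j a y z} → (∀ {x} → x < j → ¬ Bad x) → y < n → j < y → m y ≡ a → a < j →
                        z < n → j < z → m z < j → m z ≡ a
    open-label-unique {j} {a} {y} {z} ok y<n j<y refl a<j z<n j<z mz<j with <-cmp (m z) (m y)
    ... | tri≈ _ e _ = e
    ... | tri< lt _ _ = contradiction
      (proj₂ (valid y<n) , (y , y<n , <-trans a<j j<y , refl) , z , z<n , <-trans a<j j<z , lt) (ok a<j)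
    ... | tri> _ _ gt = contradiction
      (proj₂ (valid z<n) , (z , z<n , <-trans mz<j j<z , refl) , y , y<n , <-trans mz<j j<y , gt) (ok mz<j)

    Pair-unique : ∀ {j a j′ a′} → Pair j a → Pair j′ a′ → j ≡ j′ × a ≡ a′
    Pair-unique {j} {a} {j′} {a′} P P′ with <-cmp j j′
    ... | tri< lt _ _ = contradiction (Pair.bad-j P) (Pair.least P′ lt)
    ... | tri> _ _ gt = contradiction (Pair.bad-j P′) (Pair.least P gt)
    ... | tri≈ _ refl _ with y , y<n , j<y , my ← Pair.after-a P | z , z<n , j<z , mz ← Pair.after-a P′ =
      refl , trans (sym my) (open-label-unique (Pair.least P) z<n j<z mz (Pair.a<j P′) y<n j<y
        (subst (_< j) (sym my) (Pair.a<j P)))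

-- A relation between two words rather than a function, so that the same exchange can be read in
-- both directions.
Swapped : (n j a : ℕ) (m m′ : ℕ → ℕ) → Set
Swapped n j a m m′ = (∀ {y} → y < n → y ≤ j → m′ y ≡ m y) × (∀ {y} → y < n → j < y → m′ y ≡ transpose j a (m y))

Swapped-sym : ∀ {n j a m m′} → Swapped n j a m m′ → Swapped n j a m′ m
Swapped-sym {j = j} {a} {m} (lo , hi) = (λ y<n y≤j → sym (lo y<n y≤j)) , λ {y} y<n j<y →
  trans (sym (transpose-involutive j a (m y))) (cong (transpose j a) (sym (hi y<n j<y)))

module Swap {n j a : ℕ} {m m′ : ℕ → ℕ} (valid : Word.Valid n m) (P : Labels.Pair n m j a)
            (swapped : Swapped n j a m m′) where
  open Labels n m
  open Pair P
  private
    module W  = Word n m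
    module W′ = Word n m′
    module L′ = Labels n m′

    lo : ∀ {y} → y < n → y ≤ j → m′ y ≡ m y
    lo = proj₁ swapped

    hi : ∀ {y} → y < n → j < y → m′ y ≡ transpose j a (m y)
    hi = proj₂ swapped

  ma : m a ≡ a
  ma with y , y<n , _ , refl ← after-a = proj₂ (valid y<n)

  data Position (y : ℕ) : Set where
    low   : y ≤ j → m′ y ≡ m y → Position y
    to-a  : j < y → m y ≡ j → m′ y ≡ a → Position y
    to-j  : j < y → m y ≡ a → m′ y ≡ j → Position y
    fixed : j < y → m y ≢ j → m y ≢ a → m′ y ≡ m y → Position y

  position : ∀ {y} → y < n → Position y
  position {y} y<n with y ≤? j
  ... | yes y≤j = low y≤j (lo y<n y≤j)
  ... | no  y≰j with j<y ← ≰⇒> y≰j with m y ≟ j | m y ≟ a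
  ...   | yes e | _     = to-a j<y e (trans (hi y<n j<y) (trans (cong (transpose j a) e) (transpose-left j a)))
  ...   | no _  | yes e = to-j j<y e (trans (hi y<n j<y) (trans (cong (transpose j a) e) (transpose-right j a)))
  ...   | no ≢j | no ≢a = fixed j<y ≢j ≢a (trans (hi y<n j<y) (transpose-other ≢j ≢a))

  m′a : m′ a ≡ a
  m′a = trans (lo a<n (<⇒≤ a<j)) ma

  m′j : m′ j ≡ j
  m′j = trans (lo j<n ≤-refl) mj

  after-j′ : ∃ λ y → y < n × j < y × m′ y ≡ j
  after-j′ with y , y<n , j<y , my ← after-a =
    y , y<n , j<y , trans (hi y<n j<y) (trans (cong (transpose j a) my) (transpose-right j a))

  after-a′ : ∃ λ y → y < n × j < y × m′ y ≡ a
  after-a′ with y , y<n , j<y , my ← after-j =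
    y , y<n , j<y , trans (hi y<n j<y) (trans (cong (transpose j a) my) (transpose-left j a))

  min⇒min′ : ∀ {i} → i < n → m i ≡ i → m′ i ≡ i
  min⇒min′ {i} i<n e with position i<n
  ... | low _ h        = trans h e
  ... | fixed _ _ _ h  = trans h e
  ... | to-a j<i mi≡j _ = contradiction (trans (sym mi≡j) e) (<⇒≢ j<i)
  ... | to-j j<i mi≡a _ = contradiction (trans (sym mi≡a) e) (<⇒≢ (<-trans a<j j<i))

  valid′ : W′.Valid
  valid′ {i} i<n with mi≤i , idem ← valid i<n with position i<n
  ... | low i≤j h       = subst (λ z → z ≤ i × m′ z ≡ z) (sym h)
    (mi≤i , trans (lo (≤-<-trans mi≤i i<n) (≤-trans mi≤i i≤j)) idem)
  ... | to-a j<i _ h    = subst (λ z → z ≤ i × m′ z ≡ z) (sym h) (<⇒≤ (<-trans a<j j<i) , m′a)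
  ... | to-j j<i _ h    = subst (λ z → z ≤ i × m′ z ≡ z) (sym h) (<⇒≤ j<i , m′j)
  ... | fixed j<i _ _ h = subst (λ z → z ≤ i × m′ z ≡ z) (sym h) (mi≤i , min⇒min′ (≤-<-trans mi≤i i<n) idem)

  -- Labels up to position `j` are unchanged, and beyond it the same set of labels occurs in both
  -- words because `a` and `j` both occur there. Badness of `x` below `j` depends on nothing else,
  -- though its witnesses may have to move.
  bad′⇒bad : ∀ {x} → x < j → L′.Bad x → Bad x
  bad′⇒bad {x} x<j (m′x , (y , y<n , x<y , e) , (z , z<n , x<z , lt)) =
    trans (sym (lo (<-trans x<j j<n) (<⇒≤ x<j))) m′x , own , smaller
    where
    own : ∃ λ y → y < n × x < y × m y ≡ x
    own with position y<n
    ... | low _ h       = y , y<n , x<y , trans (sym h) e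
    ... | fixed _ _ _ h = y , y<n , x<y , trans (sym h) e
    ... | to-j _ _ h    = contradiction (trans (sym e) h) (<⇒≢ x<j)
    ... | to-a _ _ h with w , w<n , j<w , mw ← after-a = w , w<n , <-trans x<j j<w , trans mw (trans (sym h) e)
    smaller : ∃ λ y → y < n × x < y × m y < x
    smaller with position z<n
    ... | low _ h       = z , z<n , x<z , subst (_< x) h lt
    ... | fixed _ _ _ h = z , z<n , x<z , subst (_< x) h lt
    ... | to-j _ _ h    = contradiction (subst (_< x) h lt) (<-asym x<j)
    ... | to-a _ _ h with w , w<n , j<w , mw ← after-a =
      w , w<n , <-trans x<j j<w , subst (_< x) (trans h (sym mw)) lt

  pair′ : L′.Pair j a
  pair′ = record
    { j<n = j<n ; a<j = a<j ; mj = m′j ; after-j = after-j′ ; after-a = after-a′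
    ; least = λ x<j bad′ → least x<j (bad′⇒bad x<j bad′) }

  open-label : ∀ {y} → y < n → j < y → m y < j → m y ≡ a
  open-label y<n j<y my<j with z , z<n , j<z , mz ← after-a =
    open-label-unique valid least z<n j<z mz a<j y<n j<y my<j

  hi-cong : ∀ {x y} → x < n → y < n → j < x → j < y → m x ≡ m y → m′ x ≡ m′ y
  hi-cong x<n y<n j<x j<y e = trans (hi x<n j<x) (trans (cong (transpose j a) e) (sym (hi y<n j<y)))

  hi-injective : ∀ {x y} → x < n → y < n → j < x → j < y → m′ x ≡ m′ y → m x ≡ m y
  hi-injective x<n y<n j<x j<y e =
    transpose-injective j a (trans (sym (hi x<n j<x)) (trans e (hi y<n j<y)))

  -- Positions after `j` keep their grouping into blocks. A low position labelled `a` or `j` is last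
  -- in neither word, since both labels occur after `j` in each.
  last′⇒last : ∀ {i} → i < n → W′.Last i → W.Last i
  last′⇒last {i} i<n last′ {k} i<k k<n e with position i<n
  ... | to-a j<i _ _    = last′ i<k k<n (hi-cong k<n i<n (<-trans j<i i<k) j<i e)
  ... | to-j j<i _ _    = last′ i<k k<n (hi-cong k<n i<n (<-trans j<i i<k) j<i e)
  ... | fixed j<i _ _ _ = last′ i<k k<n (hi-cong k<n i<n (<-trans j<i i<k) j<i e)
  ... | low i≤j h with position k<n
  ...   | low _ hk       = last′ i<k k<n (trans hk (trans e (sym h)))
  ...   | fixed _ _ _ hk = last′ i<k k<n (trans hk (trans e (sym h)))
  ...   | to-a j<k mk≡j _ with y , y<n , j<y , m′y ← after-j′ =
    last′ (≤-<-trans i≤j j<y) y<n (trans m′y (trans (sym mk≡j) (trans e (sym h))))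
  ...   | to-j j<k mk≡a _ with y , y<n , j<y , m′y ← after-a′ =
    last′ (≤-<-trans i≤j j<y) y<n (trans m′y (trans (sym mk≡a) (trans e (sym h))))

  ¬last-j : ¬ W.Last j
  ¬last-j last with y , y<n , j<y , my ← after-j = last j<y y<n (trans my (sym mj))

  low-label : ∀ {y} → y < n → j < y → ∀ {v} → v < j → v ≢ a → m′ y ≡ v → m y ≡ v
  low-label y<n j<y v<j v≢a e with position y<n
  ... | low y≤j _     = contradiction j<y (≤⇒≯ y≤j)
  ... | to-a _ _ h    = contradiction (trans (sym e) h) v≢a
  ... | to-j _ _ h    = contradiction (trans (sym e) h) (<⇒≢ v<j)
  ... | fixed _ _ _ h = trans (sym h) e

  m′≡j⇒m≡a : ∀ {y} → y < n → j < y → m′ y ≡ j → m y ≡ a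
  m′≡j⇒m≡a y<n j<y e =
    transpose-injective j a (trans (sym (hi y<n j<y)) (trans e (sym (transpose-right j a))))

  m′≡a⇒m≡j : ∀ {y} → y < n → j < y → m′ y ≡ a → m y ≡ j
  m′≡a⇒m≡j y<n j<y e =
    transpose-injective j a (trans (sym (hi y<n j<y)) (trans e (sym (transpose-left j a))))

  m≡a⇒m′≡j : ∀ {y} → y < n → j < y → m y ≡ a → m′ y ≡ j
  m≡a⇒m′≡j y<n j<y e = trans (hi y<n j<y) (trans (cong (transpose j a) e) (transpose-right j a))

  m≡j⇒m′≡a : ∀ {y} → y < n → j < y → m y ≡ j → m′ y ≡ a
  m≡j⇒m′≡a y<n j<y e = trans (hi y<n j<y) (trans (cong (transpose j a) e) (transpose-left j a))

  BlockMax-hi : ∀ {x b} → x < n → j < x → W.BlockMax x b → W′.BlockMax x b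
  BlockMax-hi {x} {b} x<n j<x M@(b<n , e , maxb) = b<n , hi-cong b<n x<n (j<b) j<x e ,
      λ b<k k<n ek → maxb b<k k<n (hi-injective k<n x<n (<-trans j<b b<k) j<x ek)
    where
    j<b : j < b
    j<b = <-≤-trans j<x (W.BlockMax-≥ M x<n refl)

  <BlockMax-a : ∀ {b} → W.BlockMax a b → j < b
  <BlockMax-a M with y , y<n , j<y , my ← after-a = <-≤-trans j<y (W.BlockMax-≥ M y<n (trans my (sym ma)))

  <BlockMax-j : ∀ {b} → W.BlockMax j b → j < b
  <BlockMax-j M with y , y<n , j<y , my ← after-j = <-≤-trans j<y (W.BlockMax-≥ M y<n (trans my (sym mj)))

  -- The parts of the two blocks after `j` trade owners, so the minima `a` and `j` trade maxima
  -- while every other minimum keeps its own.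
  BlockMax-min : ∀ {i b} → i < n → m i ≡ i → W.BlockMax (transpose j a i) b → W′.BlockMax i b
  BlockMax-min {i} i<n mi = go i<n mi (transposeView j a i)
    where
    go : ∀ {i t b} → i < n → m i ≡ i → TransposeView j a i t → W.BlockMax t b → W′.BlockMax i b
    go i<n mi left M@(b<n , e , maxb) =
      b<n , trans (m≡a⇒m′≡j b<n (<BlockMax-a M) (trans e ma)) (sym m′j) ,
      λ b<k k<n ek → maxb b<k k<n (trans (m′≡j⇒m≡a k<n (<-trans (<BlockMax-a M) b<k) (trans ek m′j)) (sym ma))
    go i<n mi right M@(b<n , e , maxb) =
      b<n , trans (m≡j⇒m′≡a b<n (<BlockMax-j M) (trans e mj)) (sym m′a) ,
      λ b<k k<n ek → maxb b<k k<n (trans (m′≡a⇒m≡j k<n (<-trans (<BlockMax-j M) b<k) (trans ek m′a)) (sym mj))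
    go {i} {b = b} i<n mi (other i≢j i≢a) M@(b<n , e , maxb) with j <? i
    ... | yes j<i = BlockMax-hi i<n j<i M
    ... | no  j≮i = b<n , trans (lo b<n b≤j) (trans e (sym m′i)) , λ b<k k<n ek → maxb b<k k<n (back k<n ek)
      where
      i<j : i < j
      i<j = ≤∧≢⇒< (≮⇒≥ j≮i) i≢j
      m′i : m′ i ≡ m i
      m′i = lo i<n (<⇒≤ i<j)
      -- A block opened before `j` and reaching past `j` could only be that of `a`; the block of `i`
      -- is therefore complete by `j` and untouched.
      b≤j : b ≤ j
      b≤j = ≮⇒≥ λ j<b → i≢a (trans (sym (trans e mi)) (open-label b<n j<b (subst (_< j) (sym (trans e mi)) i<j)))
      back : ∀ {k} → k < n → m′ k ≡ m′ i → m k ≡ m i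
      back {k} k<n ek with k ≤? j
      ... | yes k≤j = trans (sym (lo k<n k≤j)) (trans ek m′i)
      ... | no  k≰j = trans (low-label k<n (≰⇒> k≰j) i<j i≢a (trans ek (trans m′i mi))) (sym mi)

  -- The arc of the block of `a` that passes over `j` starts at the last occurrence of `a` before
  -- `j`. Searching downwards from `j` finds it, at `a` itself at the latest.
  record Predecessor (p : ℕ) : Set where
    field
      p<j  : p < j
      mp   : m p ≡ a
      gap  : ∀ {k} → p < k → k < j → m k ≢ a

  predecessor : ∃ Predecessor
  predecessor = search j a<j ≤-refl λ j≤k k<j → contradiction j≤k (<⇒≱ k<j)
    where
    search : ∀ k → a < k → k ≤ j → (∀ {i} → k ≤ i → i < j → m i ≢ a) → ∃ Predecessor
    search (suc k) a<1+k k<j none with m k ≟ a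
    ... | yes mk = k , record { p<j = k<j ; mp = mk ; gap = none }
    ... | no ¬mk = search k (≤∧≢⇒< (≤-pred a<1+k) λ { refl → ¬mk ma }) (<⇒≤ k<j) λ {i} k≤i i<j mi →
      none (≤∧≢⇒< k≤i λ { refl → ¬mk mi }) i<j mi

  module _ {p : ℕ} (pred : Predecessor p) where
    open Predecessor pred

    p<n : p < n
    p<n = <-trans p<j j<n

    m′p : m′ p ≡ a
    m′p = trans (lo p<n (<⇒≤ p<j)) mp

    <Next-p : ∀ {b} → W.Next p b → j < b
    <Next-p {b} (p<b , _ , e , _) with <-cmp b j
    ... | tri< b<j _ _  = contradiction (trans e mp) (gap p<b b<j)
    ... | tri≈ _ refl _ = contradiction (trans (sym mj) (trans e mp)) (≢-sym (<⇒≢ a<j))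
    ... | tri> _ _ j<b  = j<b

    -- At j only the block of a is open.
    arc-over-j : ∀ {i b} → i < j → W.Next i b → j < b → i ≡ p
    arc-over-j {i} i<j (i<b , b<n , e , gapᵢ) j<b
      with mi≡a ← trans (sym e) (open-label b<n j<b (subst (_< j) (sym e)
                    (≤-<-trans (proj₁ (valid (<-trans i<j j<n))) i<j)))
      with <-cmp i p
    ... | tri< i<p _ _ = contradiction (trans mp (sym mi≡a)) (gapᵢ i<p (<-trans p<j j<b))
    ... | tri≈ _ i≡p _ = i≡p
    ... | tri> _ _ p<i = contradiction mi≡a (gap p<i i<j)

    -- Only two arcs change: the one leaving `j` and the one passing over `j` from `p` exchange
    -- their right ends.
    Next-swap : ∀ {i b} → i < n → W.Next (transpose j p i) b → W′.Next i b
    Next-swap {i} i<n = go i<n (transposeView j p i)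
      where
      go : ∀ {i t b} → i < n → TransposeView j p i t → W.Next t b → W′.Next i b
      go i<n left N@(p<b , b<n , e , gap-p) = j<b , b<n ,
          trans (m≡a⇒m′≡j b<n j<b (trans e mp)) (sym m′j) ,
          λ j<k k<b ek → gap-p (<-trans p<j j<k) k<b
            (trans (m′≡j⇒m≡a (<-trans k<b b<n) j<k (trans ek m′j)) (sym mp))
        where j<b = <Next-p N
      go i<n right (j<b , b<n , e , gap-j) = <-trans p<j j<b , b<n ,
        trans (m≡j⇒m′≡a b<n j<b (trans e mj)) (sym m′p) , λ {k} → clear
        where
        clear : ∀ {k} → p < k → k < _ → m′ k ≢ m′ p
        clear {k} p<k k<b ek with <-cmp k j
        ... | tri< k<j _ _  = gap p<k k<j (trans (sym (lo (<-trans k<b b<n) (<⇒≤ k<j))) (trans ek m′p))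
        ... | tri≈ _ refl _ = <⇒≢ a<j (trans (sym m′p) (trans (sym ek) m′j))
        ... | tri> _ _ j<k  = gap-j j<k k<b (trans (m′≡a⇒m≡j (<-trans k<b b<n) j<k (trans ek m′p)) (sym mj))
      go {i} {b = b} i<n (other i≢j i≢p) N@(i<b , b<n , e , gapᵢ) with j <? i
      ... | yes j<i = i<b , b<n , hi-cong b<n i<n (<-trans j<i i<b) j<i e ,
        λ i<k k<b ek → gapᵢ i<k k<b (hi-injective (<-trans k<b b<n) i<n (<-trans j<i i<k) j<i ek)
      ... | no  j≮i = i<b , b<n , trans (lo b<n b≤j) (trans e (sym m′i)) ,
        λ i<k k<b ek → gapᵢ i<k k<b (trans (sym (lo (<-trans k<b b<n) (<⇒≤ (<-≤-trans k<b b≤j)))) (trans ek m′i))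
        where
        i<j : i < j
        i<j = ≤∧≢⇒< (≮⇒≥ j≮i) i≢j
        m′i : m′ i ≡ m i
        m′i = lo i<n (<⇒≤ i<j)
        b≤j : b ≤ j
        b≤j = ≮⇒≥ λ j<b → i≢p (arc-over-j i<j N j<b)

-- Flatness and the exchange as seen by the statistics

module _ {n : ℕ} {ms : List ℕ} (valid : Word.Valid n (at ms)) where
  open Word n (at ms)
  open Labels n (at ms)
  open Facts n ms
  open Encoding n ms

  -- Whatever is open at `x` belongs to the block of `x`. For blocks this gives equal maxima; for
  -- arcs it is contradictory, because `x` would then lie between an element and its right
  -- neighbour.
  flat-encoding : ∀ γ ℓ {j} → j ≤ n → (∀ {x} → x < j → ¬ Bad x) → Flat (guard γ) (source ℓ) (target ℓ) j
  flat-encoding γ arcs j≤n ok {x} {i} x<j gx i<x si x<ui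
    with _ , u<n , e , gapᵢ ← nextℕ-spec (T⇒reflects (nonmax-reflects i) si) =
    contradiction
      (sym (spanned⇒same valid j≤n ok x<j (guard⇒¬Last valid γ (<-≤-trans x<j j≤n) gx) i<x x<ui u<n e))
      (gapᵢ i<x x<ui)
  flat-encoding γ blocks j≤n ok {x} {i} x<j gx i<x si x<ui
    with x<n ← <-≤-trans x<j j≤n
    with i<n ← <-trans i<x x<n
    with u<n , e , _ ← bmax-spec i<n =
    bmax-cong i<n x<n (spanned⇒same valid j≤n ok x<j (guard⇒¬Last valid γ x<n gx) i<x x<ui u<n e)

  flat-modelStat : ∀ s → (∀ {x} → x < n → ¬ Bad x) → modelStat s n ms ≡ 0
  flat-modelStat s ok = flat-total {n} (kind s) (flat-encoding (guardOf s) (levelOf s) ≤-refl ok)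

module _ {n j a : ℕ} {ms ms′ : List ℕ} (valid : Word.Valid n (at ms)) (P : Labels.Pair n (at ms) j a)
         (swapped : Swapped n j a (at ms) (at ms′)) where
  private
    m m′ : ℕ → ℕ
    m  = at ms
    m′ = at ms′
    module W = Word n m
    module S  = Swap {m = m} {m′} valid P swapped
    -- The exchange is symmetric, so each one-way fact proved in `Swap` yields its converse here.
    module S′ = Swap {m = m′} {m} S.valid′ S.pair′ (Swapped-sym {m = m} {m′} swapped)
    module F  = Facts n ms
    module F′ = Facts n ms′
    module E  = Encoding n ms
    module E′ = Encoding n ms′
    module T  = Structure n ms
    module T′ = Structure n ms′
  open Labels.Pair P

  isMax-swap : ∀ {x} → x < n → T′.isMax x ≡ T.isMax x
  isMax-swap {x} x<n = reflects⇒≡ (F′.isMax-reflects x) (F.isMax-reflects x)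
    (λ last′ → S.last′⇒last x<n last′) (λ last → S′.last′⇒last x<n last)

  isMin-swap : ∀ {x} → x < n → T′.isMin x ≡ T.isMin x
  isMin-swap x<n = reflects⇒≡ (F′.isMin-reflects S.valid′ x<n) (F.isMin-reflects valid x<n)
    (S′.min⇒min′ x<n) (S.min⇒min′ x<n)

  guard-swap : ∀ γ {x} → x < n → E′.guard γ x ≡ E.guard γ x
  guard-swap allActive x<n = cong not (isMax-swap x<n)
  guard-swap openers   x<n = reflects⇒≡ (F′.opener-reflects S.valid′ x<n) (F.opener-reflects valid x<n)
    (λ { (e , ¬last) → S′.min⇒min′ x<n e , λ last → ¬last (S′.last′⇒last x<n last) })
    (λ { (e , ¬last) → S.min⇒min′ x<n e , λ last → ¬last (S.last′⇒last x<n last) })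

  source-swap : ∀ ℓ {x} → x < n → E′.source ℓ x ≡ E.source ℓ x
  source-swap arcs   x<n = cong not (isMax-swap x<n)
  source-swap blocks x<n = isMin-swap x<n

  guard-j : ∀ γ → T (E.guard γ j)
  guard-j allActive = reflects⇒T (F.nonmax-reflects j) S.¬last-j
  guard-j openers   = reflects⇒T (F.opener-reflects valid j<n) (mj , S.¬last-j)

  -- The rival of `j` depends on the level: for arcs it is the last element before `j` in the block
  -- of `a`, for blocks it is `a`.
  switch : ∀ γ ℓ → ∃ λ q → Switch n j q (E.guard γ) (E′.guard γ) (E.source ℓ) (E′.source ℓ) (E.target ℓ) (E′.target ℓ)
  switch γ arcs with p , pred ← S.predecessor = p , record
    { q<j = p<j ; j<n = j<n ; gj = guard-j γ
    ; srcj = reflects⇒T (F.nonmax-reflects j) S.¬last-j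
    ; srcq = reflects⇒T (F.nonmax-reflects p) ¬last-p
    ; g′≡g = guard-swap γ
    ; s′≡s = source-swap arcs
    ; u′-src = λ {i} i<n si → next-swap i<n (T⇒reflects (F.nonmax-reflects i) si)
    ; u′-hi = λ {x} j<x x<n gx → trans (next-swap x<n (E.guard⇒¬Last valid γ x<n gx))
        (cong T.nextℕ (transpose-other (≢-sym (<⇒≢ j<x)) (≢-sym (<⇒≢ (<-trans p<j j<x)))))
    ; j<uj = proj₁ (F.nextℕ-spec S.¬last-j)
    ; j<uq = S.<Next-p pred (F.nextℕ-spec ¬last-p)
    ; uj≢uq = λ e → <⇒≢ p<j (W.Next-injective (F.nextℕ-spec ¬last-p)
        (subst (W.Next j) e (F.nextℕ-spec S.¬last-j)))
    ; only = λ {i} i<j si j<ui → S.arc-over-j pred i<j (F.nextℕ-spec (T⇒reflects (F.nonmax-reflects i) si)) j<ui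
    ; flat = flat-encoding {ms = ms} valid γ arcs (<⇒≤ j<n) least
    ; flat′ = flat-encoding {ms = ms′} S.valid′ γ arcs (<⇒≤ j<n) (Labels.Pair.least S.pair′) }
    where
    open S.Predecessor pred
    ¬last-p : ¬ W.Last p
    ¬last-p last with y , y<n , j<y , my ← after-a = last (<-trans p<j j<y) y<n (trans my (sym mp))
    ¬last-transpose : ∀ {i} → ¬ W.Last i → ¬ W.Last (transpose j p i)
    ¬last-transpose {i} ¬last with transpose j p i | transposeView j p i
    ... | _ | left      = ¬last-p
    ... | _ | right     = S.¬last-j
    ... | _ | other _ _ = ¬last
    next-swap : ∀ {i} → i < n → ¬ W.Last i → T′.nextℕ i ≡ T.nextℕ (transpose j p i)
    next-swap {i} i<n ¬last = Word.Next-unique n m′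
      (F′.nextℕ-spec λ last′ → ¬last (S.last′⇒last i<n last′))
      (S.Next-swap pred i<n (F.nextℕ-spec (¬last-transpose ¬last)))
  switch γ blocks = a , record
    { q<j = a<j ; j<n = j<n ; gj = guard-j γ
    ; srcj = reflects⇒T (F.isMin-reflects valid j<n) mj
    ; srcq = reflects⇒T (F.isMin-reflects valid a<n) S.ma
    ; g′≡g = guard-swap γ
    ; s′≡s = source-swap blocks
    ; u′-src = λ {i} i<n si → Word.BlockMax-unique n m′ (F′.bmax-spec i<n)
        (S.BlockMax-min i<n (T⇒reflects (F.isMin-reflects valid i<n) si) (F.bmax-spec (transpose-< j<n a<n i<n)))
    ; u′-hi = λ j<x x<n _ → Word.BlockMax-unique n m′ (F′.bmax-spec x<n) (S.BlockMax-hi x<n j<x (F.bmax-spec x<n))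
    ; j<uj = F.¬Last⇒<bmax j<n S.¬last-j
    ; j<uq = S.<BlockMax-a (F.bmax-spec a<n)
    ; uj≢uq = λ e → <⇒≢ a<j (trans (sym S.ma) (trans (sym (F.bmax-injective j<n a<n e)) mj))
    ; only = λ {i} i<j si j<ui → let i<n = <-trans i<j j<n
                                     mi = T⇒reflects (F.isMin-reflects valid i<n) si
                                     (u<n , e , _) = F.bmax-spec i<n
        in trans (sym (trans e mi)) (S.open-label u<n j<ui (subst (_< j) (sym (trans e mi)) i<j))
    ; flat = flat-encoding {ms = ms} valid γ blocks (<⇒≤ j<n) least
    ; flat′ = flat-encoding {ms = ms′} S.valid′ γ blocks (<⇒≤ j<n) (Labels.Pair.least S.pair′) }

  modelStat-swap : ∀ s → Adjacent (modelStat s n ms) (modelStat s n ms′)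
  modelStat-swap s = switch-total (proj₂ (switch (guardOf s) (levelOf s))) (kind s)

-- The list of all partitions: no repetitions, none missing

data Link {n : ℕ} (v : Vec ℕ n) (b : Bool) (f : T b → Π n) : Set where
  link : (∀ t → ∃ λ t′ → f t ≡ mkΠ v t′) → (T (validL n (toList v)) → T b) → Link v b f

data Collected {n : ℕ} (v : Vec ℕ n) (πs : List (Π n)) : List (Π n) → Set where
  keep : ∀ t → Collected v πs (mkΠ v t ∷ πs)
  skip : ¬ T (validL n (toList v)) → Collected v πs πs

-- The data types Link and Collected hide the occurrences of validL and mkΠ v that
-- would make abstracting the branching of collect ill-typed.
collect-∷ : ∀ {n} (v : Vec ℕ n) vs → Collected v (collect n vs) (collect n (v ∷ vs))
collect-∷ {n} v vs = go (link {v = v} (λ t → t , refl) id)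
  where
  go : Link v (validL n (toList v)) (mkΠ v) → Collected v (collect n vs) (collect n (v ∷ vs))
  go l with validL n (toList v) | mkΠ {n} v | l
  ... | true  | f | link h _ with t′ , e ← h _ = subst (λ π → Collected v (collect n vs) (π ∷ collect n vs)) (sym e) (keep t′)
  ... | false | f | link _ h = skip h

collect-∈⁺ : ∀ {n} {v : Vec ℕ n} vs t → v ∈ vs → mkΠ v t ∈ collect n vs
collect-∈⁺ {n} (w ∷ vs) t v∈ with collect n (w ∷ vs) | collect-∷ w vs | v∈
... | _ | keep t′     | here refl = here (cong (mkΠ _) (T-irrelevant t t′))
... | _ | keep _      | there v∈  = there (collect-∈⁺ vs t v∈)
... | _ | skip ¬valid | here refl = contradiction t ¬valid
... | _ | skip _      | there v∈  = collect-∈⁺ vs t v∈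

collect-∈⁻ : ∀ {n} {π : Π n} vs → π ∈ collect n vs → vec π ∈ vs
collect-∈⁻ {n} (w ∷ vs) π∈ with collect n (w ∷ vs) | collect-∷ w vs | π∈
... | _ | keep _ | here refl = here refl
... | _ | keep _ | there π∈  = there (collect-∈⁻ vs π∈)
... | _ | skip _ | π∈        = there (collect-∈⁻ vs π∈)

collect-unique : ∀ {n} {vs : List (Vec ℕ n)} → Unique vs → Unique (collect n vs)
collect-unique {n} {[]} [] = []
collect-unique {n} {w ∷ vs} (w∉ ∷ u) with collect n (w ∷ vs) | collect-∷ w vs
... | _ | keep t = All.tabulate (λ π∈ e → All.lookup w∉ (collect-∈⁻ vs π∈) (cong vec e)) ∷ collect-unique u
... | _ | skip _ = collect-unique u

-- Moves a count from partitions to arbitrary vectors, where a recursion on positions need not carry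
-- validity along.
∑-collect : ∀ {n} {f : Π n → ℕ} {g : Vec ℕ n → ℕ} vs → (∀ π → f π ≡ g (vec π)) →
            (∀ v → ¬ T (validL n (toList v)) → g v ≡ 0) → ∑ (collect n vs) f ≡ ∑ vs g
∑-collect [] f≡g g≡0 = refl
∑-collect {n} {g = g} (w ∷ vs) f≡g g≡0 with collect n (w ∷ vs) | collect-∷ w vs
... | _ | keep t = cong₂ _+_ (f≡g (mkΠ w t)) (∑-collect vs f≡g g≡0)
... | _ | skip ¬valid = trans (∑-collect vs f≡g g≡0) (cong (_+ ∑ vs g) (sym (g≡0 w ¬valid)))

vecsBelow-unique : ∀ n k → Unique (vecsBelow n k)
vecsBelow-unique zero    k = [] ∷ []
vecsBelow-unique (suc n) k = Unique.concat⁺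
  (All.map⁺ (All.tabulate λ _ → Unique.map⁺ (proj₂ ∘ ∷-injective) (vecsBelow-unique n k)))
  (AllPairs.map⁺ (AllPairs.map disjoint (Unique.upTo⁺ k)))
  where
  disjoint : ∀ {x y} → x ≢ y → Disjoint (map (x Vec.∷_) (vecsBelow n k)) (map (y Vec.∷_) (vecsBelow n k))
  disjoint x≢y (v∈ , v∈′) with _ , _ , refl ← ∈-map⁻ _ v∈ | _ , _ , e ← ∈-map⁻ _ v∈′ =
    x≢y (proj₁ (∷-injective e))

vecsBelow-complete : ∀ {n k} (v : Vec ℕ n) → (∀ {i} → i < n → at (toList v) i < k) → v ∈ vecsBelow n k
vecsBelow-complete Vec.[] _ = here refl
vecsBelow-complete {suc n} {k} (x Vec.∷ v) bound = ∈-concat⁺′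
  (∈-map⁺ (x Vec.∷_) (vecsBelow-complete v λ i<n → bound (s<s i<n)))
  (∈-map⁺ (λ x → map (x Vec.∷_) (vecsBelow n k)) (∈-upTo⁺ (bound z<s)))

allΠ-unique : ∀ n → Unique (allΠ n)
allΠ-unique n = collect-unique (vecsBelow-unique n n)

allΠ-complete : ∀ {n} (π : Π n) → π ∈ allΠ n
allΠ-complete π = collect-∈⁺ _ (valid π)
  (vecsBelow-complete (vec π) λ i<n → ≤-<-trans (proj₁ (word-valid π i<n)) i<n)

at-tabulate : ∀ n (f : ℕ → ℕ) {i} → i < n → at (toList (tabulate {n = n} (f ∘ toℕ))) i ≡ f i
at-tabulate (suc n) f {zero}  _         = refl
at-tabulate (suc n) f {suc i} (s≤s i<n) = at-tabulate n (f ∘ suc) i<n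

at-injective : ∀ {n} (v w : Vec ℕ n) → (∀ {i} → i < n → at (toList v) i ≡ at (toList w) i) → v ≡ w
at-injective Vec.[] Vec.[] _ = refl
at-injective (x Vec.∷ v) (y Vec.∷ w) e = cong₂ Vec._∷_ (e z<s) (at-injective v w λ i<n → e (s<s i<n))

word-injective : ∀ {n} (π ρ : Π n) → (∀ {i} → i < n → word π i ≡ word ρ i) → π ≡ ρ
word-injective (mkΠ v t) (mkΠ w t′) e with refl ← at-injective v w e = cong (mkΠ v) (T-irrelevant t t′)

-- The exchange as an involution on partitions

swapLabels : (j a : ℕ) → (ℕ → ℕ) → ℕ → ℕ
swapLabels j a m y with y ≤? j
... | yes _ = m y
... | no  _ = transpose j a (m y)

swapLabels-Swapped : ∀ {n j a} m m′ → (∀ {y} → y < n → m′ y ≡ swapLabels j a m y) → Swapped n j a m m′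
swapLabels-Swapped {n} {j} {a} m m′ m′≡ =
  (λ y<n y≤j → trans (m′≡ y<n) (below y≤j)) , (λ y<n j<y → trans (m′≡ y<n) (above j<y))
  where
  below : ∀ {y} → y ≤ j → swapLabels j a m y ≡ m y
  below {y} y≤j with y ≤? j
  ... | yes _   = refl
  ... | no  y≰j = contradiction y≤j y≰j
  above : ∀ {y} → j < y → swapLabels j a m y ≡ transpose j a (m y)
  above {y} j<y with y ≤? j
  ... | yes y≤j = contradiction j<y (≤⇒≯ y≤j)
  ... | no  _   = refl

Swapped-unique : ∀ {n j a m m₁ m₂} → Swapped n j a m m₁ → Swapped n j a m m₂ → ∀ {i} → i < n → m₁ i ≡ m₂ i
Swapped-unique {j = j} (lo₁ , hi₁) (lo₂ , hi₂) {i} i<n with i ≤? j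
... | yes i≤j = trans (lo₁ i<n i≤j) (sym (lo₂ i<n i≤j))
... | no  i≰j = trans (hi₁ i<n (≰⇒> i≰j)) (sym (hi₂ i<n (≰⇒> i≰j)))

least-or-none : ∀ {P : ℕ → Set} → Decidable P → ∀ k →
  (∃ λ x → x < k × P x × ∀ {y} → y < x → ¬ P y) ⊎ (∀ {x} → x < k → ¬ P x)
least-or-none P? zero = inj₂ λ ()
least-or-none P? (suc k) with least-or-none P? k | P? k
... | inj₁ (x , x<k , Px , min) | _ = inj₁ (x , m<n⇒m<1+n x<k , Px , min)
... | inj₂ none | yes Pk = inj₁ (k , ≤-refl , Pk , none)
... | inj₂ none | no ¬Pk = inj₂ λ x<1+k Px → none (≤∧≢⇒< (≤-pred x<1+k) λ { refl → ¬Pk Px }) Px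

module _ {n : ℕ} where
  open Labels n

  swapVec : (π : Π n) (j a : ℕ) → Vec ℕ n
  swapVec π j a = tabulate (swapLabels j a (word π) ∘ toℕ)

  swapVec-Swapped : ∀ π j a → Swapped n j a (word π) (at (toList (swapVec π j a)))
  swapVec-Swapped π j a = swapLabels-Swapped _ _ (at-tabulate n (swapLabels j a (word π)))

  swapΠ : (π : Π n) → ∀ {j a} → Pair (word π) j a → Π n
  swapΠ π {j} {a} P = mkΠ (swapVec π j a) (reflects⇒T (validL-reflects n (toList (swapVec π j a)))
    (Swap.valid′ (word-valid π) P (swapVec-Swapped π j a)))

  Bad? : ∀ m → Decidable (Bad m)
  Bad? m x = (m x ≟ x) ×-dec anyUpTo? (λ y → (x <? y) ×-dec (m y ≟ x)) n
                       ×-dec anyUpTo? (λ y → (x <? y) ×-dec (m y <? x)) n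

  FlatWord : (ℕ → ℕ) → Set
  FlatWord m = ∀ {x} → x < n → ¬ Bad m x

  pair-or-flat : (π : Π n) → (∃₂ λ j a → Pair (word π) j a) ⊎ FlatWord (word π)
  pair-or-flat π with least-or-none (Bad? (word π)) n
  ... | inj₂ flat = inj₂ flat
  ... | inj₁ (j , j<n , (mj , after-j , y , y<n , j<y , my<j) , least) = inj₁ (j , word π y , record
    { j<n = j<n ; a<j = my<j ; mj = mj ; after-j = after-j ; after-a = y , y<n , j<y , refl ; least = least })

  swapFirst : Π n → Π n
  swapFirst π with pair-or-flat π
  ... | inj₁ (_ , _ , P) = swapΠ π P
  ... | inj₂ _           = π

  -- The exchanged partition still has the pair `j`, `a`, and a word has at most one pair, so the
  -- second application must exchange the same labels.
  swapFirst-involutive : ∀ π → swapFirst (swapFirst π) ≡ π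
  swapFirst-involutive π with pair-or-flat π in eq
  ... | inj₂ _ rewrite eq = refl
  ... | inj₁ (j , a , P) with pair-or-flat (swapΠ π P)
  ...   | inj₂ flat = contradiction (Pair.bad-j _ P′) (flat (Pair.j<n P))
    where P′ = Swap.pair′ (word-valid π) P (swapVec-Swapped π j a)
  ...   | inj₁ (j′ , a′ , P′)
    with refl , refl ← Pair-unique _ (word-valid (swapΠ π P)) P′ (Swap.pair′ (word-valid π) P (swapVec-Swapped π j a)) =
    word-injective _ π (Swapped-unique {m = word (swapΠ π P)} (swapVec-Swapped (swapΠ π P) j a)
      (Swapped-sym {m = word π} (swapVec-Swapped π j a)))

  flatᵇ : Π n → Bool
  flatᵇ π with pair-or-flat π
  ... | inj₁ _ = false
  ... | inj₂ _ = true

  flatᵇ-reflects : ∀ π → Reflects (FlatWord (word π)) (flatᵇ π)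
  flatᵇ-reflects π with pair-or-flat π
  ... | inj₁ (_ , _ , P) = ofⁿ λ flat → flat (Pair.j<n P) (Pair.bad-j _ P)
  ... | inj₂ flat        = ofʸ flat

-- Signed sums

sign : ℕ → ℤ
sign k = (ℤ.- (pos 1)) ℤ.^ k

Adjacent⇒cancel : ∀ {k l} → Adjacent k l → sign k ℤ.+ sign l ≡ pos 0
Adjacent⇒cancel {k} (inj₁ refl) = trans (cong (ℤ._+_ (sign k)) (ℤ.-1*i≡-i (sign k))) (ℤ.+-inverseʳ (sign k))
Adjacent⇒cancel {_} {l} (inj₂ refl) = trans (cong (ℤ._+ sign l) (ℤ.-1*i≡-i (sign l))) (ℤ.+-inverseˡ (sign l))

∑ℤ : {A : Set} → List A → (A → ℤ) → ℤ
∑ℤ xs f = foldr (λ x acc → f x ℤ.+ acc) (pos 0) xs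

module _ {A : Set} where

  ∑ℤ-cong : ∀ (xs : List A) {f g : A → ℤ} → (∀ x → f x ≡ g x) → ∑ℤ xs f ≡ ∑ℤ xs g
  ∑ℤ-cong [] h = refl
  ∑ℤ-cong (x ∷ xs) h = cong₂ ℤ._+_ (h x) (∑ℤ-cong xs h)

  ∑ℤ-distrib-+ : ∀ (xs : List A) (f g : A → ℤ) → ∑ℤ xs (λ x → f x ℤ.+ g x) ≡ ∑ℤ xs f ℤ.+ ∑ℤ xs g
  ∑ℤ-distrib-+ [] f g = refl
  ∑ℤ-distrib-+ (x ∷ xs) f g =
    trans (cong (ℤ._+_ (f x ℤ.+ g x)) (∑ℤ-distrib-+ xs f g)) (ℤ+.interchange (f x) (g x) (∑ℤ xs f) (∑ℤ xs g))

  ∑ℤ-map : ∀ (τ : A → A) xs (f : A → ℤ) → ∑ℤ (map τ xs) f ≡ ∑ℤ xs (f ∘ τ)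
  ∑ℤ-map τ [] f = refl
  ∑ℤ-map τ (x ∷ xs) f = cong (ℤ._+_ (f (τ x))) (∑ℤ-map τ xs f)

  ∑ℤ-↭ : ∀ {xs ys : List A} (f : A → ℤ) → xs ↭ ys → ∑ℤ xs f ≡ ∑ℤ ys f
  ∑ℤ-↭ f ↭.refl = refl
  ∑ℤ-↭ f (↭.prep x p) = cong (ℤ._+_ (f x)) (∑ℤ-↭ f p)
  ∑ℤ-↭ f (↭.swap {xs} x y p) =
    trans (ℤ+.x∙yz≈y∙xz (f x) (f y) (∑ℤ xs f)) (cong (λ z → f y ℤ.+ (f x ℤ.+ z)) (∑ℤ-↭ f p))
  ∑ℤ-↭ f (↭.trans p q) = trans (∑ℤ-↭ f p) (∑ℤ-↭ f q)

  ∑ℤ-pos : ∀ (xs : List A) (f : A → ℕ) → ∑ℤ xs (pos ∘ f) ≡ pos (∑ xs f)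
  ∑ℤ-pos [] f = refl
  ∑ℤ-pos (x ∷ xs) f = cong (ℤ._+_ (pos (f x))) (∑ℤ-pos xs f)

i+i-injective : ∀ i j → i ℤ.+ i ≡ j ℤ.+ j → i ≡ j
i+i-injective i j e = ℤ.*-cancelˡ-≡ (pos 2) i j (trans (double i) (trans e (sym (double j))))
  where
  double : ∀ i → pos 2 ℤ.* i ≡ i ℤ.+ i
  double i = trans (ℤ.*-distribʳ-+ i (pos 1) (pos 1)) (cong₂ ℤ._+_ (ℤ.*-identityˡ i) (ℤ.*-identityˡ i))

stat-flat : ∀ s {n} (π : Π n) → FlatWord {n} (word π) → stat s π ≡ 0
stat-flat s π flat = trans (stat-model s π) (flat-modelStat {ms = toList (vec π)} (word-valid π) s flat)

stat-swapΠ : ∀ s {n} (π : Π n) {j a} (P : Labels.Pair n (word π) j a) → Adjacent (stat s π) (stat s (swapΠ π P))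
stat-swapΠ s π P = subst₂ Adjacent (sym (stat-model s π)) (sym (stat-model s (swapΠ π P)))
  (modelStat-swap {ms = toList (vec π)} (word-valid π) P (swapVec-Swapped π _ _) s)

sign-swapFirst : ∀ s {n} (π : Π n) → sign (stat s π) ℤ.+ sign (stat s (swapFirst π)) ≡ pos (𝟙 (flatᵇ π) + 𝟙 (flatᵇ π))
sign-swapFirst s π with pair-or-flat π
... | inj₁ (_ , _ , P) = Adjacent⇒cancel (stat-swapΠ s π P)
... | inj₂ flat = cong (λ k → sign k ℤ.+ sign k) (stat-flat s π flat)

-- Doubling the sum pairs every partition with its image without choosing orbit representatives:
-- moved partitions contribute opposite signs, flat ones contribute 2, and doubling is injective on
-- the integers.
genPoly-−1 : ∀ s n → genPoly s n (ℤ.- (pos 1)) ≡ pos (countᵇ flatᵇ (allΠ n))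
genPoly-−1 s n = i+i-injective _ _ (begin
  ∑ℤ πs f ℤ.+ ∑ℤ πs f                             ≡⟨ cong (ℤ._+_ (∑ℤ πs f)) (∑ℤ-↭ f (involution-↭ (allΠ-unique n) (λ π _ → allΠ-complete _) swapFirst-involutive)) ⟨
  ∑ℤ πs f ℤ.+ ∑ℤ (map swapFirst πs) f             ≡⟨ cong (ℤ._+_ (∑ℤ πs f)) (∑ℤ-map swapFirst πs f) ⟩
  ∑ℤ πs f ℤ.+ ∑ℤ πs (f ∘ swapFirst)               ≡⟨ ∑ℤ-distrib-+ πs f (f ∘ swapFirst) ⟨
  ∑ℤ πs (λ π → f π ℤ.+ f (swapFirst π))            ≡⟨ ∑ℤ-cong πs (sign-swapFirst s) ⟩
  ∑ℤ πs (λ π → pos (𝟙 (flatᵇ π) + 𝟙 (flatᵇ π)))      ≡⟨ ∑ℤ-pos πs (λ π → 𝟙 (flatᵇ π) + 𝟙 (flatᵇ π)) ⟩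
  pos (∑ πs (λ π → 𝟙 (flatᵇ π) + 𝟙 (flatᵇ π)))       ≡⟨ cong pos (∑-distrib-+ πs (𝟙 ∘ flatᵇ) (𝟙 ∘ flatᵇ)) ⟩
  pos (∑ πs (𝟙 ∘ flatᵇ) + ∑ πs (𝟙 ∘ flatᵇ))         ≡⟨ cong (λ c → pos (c + c)) (count-∑ flatᵇ πs) ⟨
  pos (countᵇ flatᵇ πs) ℤ.+ pos (countᵇ flatᵇ πs)         ∎)
  where
  open ≡-Reasoning
  πs = allΠ n
  f : Π n → ℤ
  f π = sign (stat s π)

genPoly-1 : ∀ s n → genPoly s n (pos 1) ≡ pos (length (allΠ n))
genPoly-1 s n = go (allΠ n)
  where
  go : ∀ πs → foldr (λ π acc → (pos 1) ℤ.^ stat s π ℤ.+ acc) (pos 0) πs ≡ pos (length πs)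
  go [] = refl
  go (π ∷ πs) = cong₂ ℤ._+_ (ℤ.^-zeroˡ (stat s π)) (go πs)

-- Counting flat partitions

-- c can still be extended at position i without creating a bad opener.
Extendable : (ℕ → ℕ) → ℕ → ℕ → Set
Extendable m i c = c < i × m c ≡ c × ∀ {y} → c < y → y < i → m y ≡ c ⊎ m y ≡ y

-- Unlike `Bad`, whose witnesses lie to the right, this looks only at labels up to `i`, so it can be
-- tested in one pass from left to right. It also implies validity, so invalid vectors are rejected
-- by the same test.
Good : (ℕ → ℕ) → ℕ → Set
Good m i = m i ≡ i ⊎ Extendable m i (m i)

module _ {n : ℕ} {m : ℕ → ℕ} where
  open Word n m
  open Labels n m

  -- A position strictly between `m i` and `i` that is not its own minimum and has a label other
  -- than `m i` would make the larger of the two labels bad.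
  flat⇒good : Valid → (∀ {x} → x < n → ¬ Bad x) → ∀ i → i < n → Good m i
  flat⇒good valid flat i i<n with m i ≟ i
  ... | yes e = inj₁ e
  ... | no  e with mi≤i , idem ← valid i<n with mi<i ← ≤∧≢⇒< mi≤i e = inj₂ (mi<i , idem , between)
    where
    between : ∀ {y} → m i < y → y < i → m y ≡ m i ⊎ m y ≡ y
    between {y} mi<y y<i with y<n ← <-trans y<i i<n with my≤y , idy ← valid y<n with m y ≟ y | <-cmp (m y) (m i)
    ... | yes my≡y | _ = inj₂ my≡y
    ... | no _ | tri≈ _ same _ = inj₁ same
    ... | no _ | tri< lt _ _ = contradiction
      (idem , (i , i<n , mi<i , refl) , y , y<n , mi<y , lt) (flat (<-trans mi<i i<n))
    ... | no ≢ | tri> _ _ gt = contradiction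
      (idy , (y , y<n , ≤∧≢⇒< my≤y ≢ , refl) , i , i<n , ≤-<-trans my≤y y<i , gt) (flat (≤-<-trans my≤y y<n))

  good⇒valid : (∀ i → i < n → Good m i) → Valid
  good⇒valid good {i} i<n with good _ i<n
  ... | inj₁ e                = ≤-reflexive e , cong m e
  ... | inj₂ (mi<i , idem , _) = <⇒≤ mi<i , idem

  -- Of the two witnesses of badness, the earlier one lies between the later one and its label, and
  -- it obstructs extending that label.
  good⇒flat : (∀ i → i < n → Good m i) → ∀ {x} → x < n → ¬ Bad x
  good⇒flat good {x} x<n (mx , (y , y<n , x<y , my) , (z , z<n , x<z , mz<x)) with <-cmp z y
  ... | tri≈ _ refl _ = <⇒≢ mz<x my
  ... | tri< z<y _ _ with good _ y<n
  ...   | inj₁ my≡y = <⇒≢ x<y (trans (sym my) my≡y)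
  ...   | inj₂ (_ , _ , between) with between (subst (_< z) (sym my) x<z) z<y
  ...     | inj₁ same = <⇒≢ mz<x (trans same my)
  ...     | inj₂ mz≡z = <⇒≢ (<-trans mz<x x<z) mz≡z
  good⇒flat good {x} x<n (mx , (y , y<n , x<y , my) , (z , z<n , x<z , mz<x)) | tri> _ _ y<z with good _ z<n
  ... | inj₁ mz≡z = <⇒≢ (<-trans mz<x x<z) mz≡z
  ... | inj₂ (_ , _ , between) with between (<-trans mz<x x<y) y<z
  ...   | inj₁ same = <⇒≢ mz<x (trans (sym same) my)
  ...   | inj₂ my≡y = <⇒≢ x<y (trans (sym my) my≡y)

member : ℕ → List ℕ → Bool
member x = any (x ≡ᵇ_)

member-reflects : ∀ x cs → Reflects (x ∈ cs) (member x cs)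
member-reflects x cs = reflects-map (λ { (c , c∈ , refl) → c∈ }) (λ x∈ → x , x∈ , refl)
  (any-reflects cs λ c _ → ≡ᵇ-reflects x c)

-- cs lists the labels that are extendable at position i.
run : ℕ → List ℕ → List ℕ → Bool
run i cs []       = true
run i cs (x ∷ xs) =
  if x ≡ᵇ i then run (suc i) (i ∷ cs) xs else
  if member x cs then run (suc i) (x ∷ []) xs else false

GoodFrom : (ℕ → ℕ) → ℕ → ℕ → Set
GoodFrom m i r = ∀ k → i ≤ k → k < r + i → Good m k

GoodFrom-suc : ∀ {m i r b} → Good m i → Reflects (GoodFrom m (suc i) r) b → Reflects (GoodFrom m i (suc r)) b
GoodFrom-suc {m} {i} {r} good = reflects-map to λ h k i<k k< → h k (<⇒≤ i<k) (subst (k <_) (+-suc r i) k<)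
  where
  to : GoodFrom m (suc i) r → GoodFrom m i (suc r)
  to h k i≤k k< with i ≟ k
  ... | yes refl = good
  ... | no  i≢k  = h k (≤∧≢⇒< i≤k i≢k) (subst (k <_) (sym (+-suc r i)) k<)

<suc-cases : ∀ {y i} → y < suc i → y ≡ i ⊎ y < i
<suc-cases {y} {i} y<1+i with y ≟ i
... | yes y≡i = inj₁ y≡i
... | no  y≢i = inj₂ (≤∧≢⇒< (≤-pred y<1+i) y≢i)

Extendable-suc : ∀ {m i c} → m i ≡ c ⊎ m i ≡ i → Extendable m i c → Extendable m (suc i) c
Extendable-suc {m} {i} {c} mi (c<i , mc , between) = m<n⇒m<1+n c<i , mc , between′
  where
  between′ : ∀ {y} → c < y → y < suc i → m y ≡ c ⊎ m y ≡ y
  between′ c<y y<1+i with <suc-cases y<1+i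
  ... | inj₁ refl = mi
  ... | inj₂ y<i  = between c<y y<i

Extendable-pred : ∀ {m i c} → c < i → Extendable m (suc i) c → Extendable m i c
Extendable-pred c<i (_ , mc , between) = c<i , mc , λ c<y y<i → between c<y (m<n⇒m<1+n y<i)

-- Both invariants on `cs` are used: soundness justifies accepting an old label, completeness
-- justifies rejecting one.
run-reflects : ∀ {m i cs} xs → (∀ k → k < length xs → at xs k ≡ m (k + i)) →
               (∀ {c} → c ∈ cs → Extendable m i c) → (∀ {c} → Extendable m i c → c ∈ cs) →
               Reflects (GoodFrom m i (length xs)) (run i cs xs)
run-reflects [] _ _ _ = ofʸ λ _ i≤k k<i → contradiction i≤k (<⇒≱ k<i)
run-reflects {m} {i} {cs} (x ∷ xs) at≡ sound complete
  with x ≡ᵇ i | ≡ᵇ-reflects x i | member x cs | member-reflects x cs | at≡ 0 z<s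
     | (λ k k< → trans (at≡ (suc k) (s<s k<)) (cong m (sym (+-suc k i))))
... | true | ofʸ refl | _ | _ | x≡mi | at≡′ =
  GoodFrom-suc (inj₁ (sym x≡mi)) (run-reflects xs at≡′ sound′ complete′)
  where
  sound′ : ∀ {c} → c ∈ i ∷ cs → Extendable m (suc i) c
  sound′ (here refl) = ≤-refl , sym x≡mi , λ i<y y<1+i → contradiction (≤-pred y<1+i) (<⇒≱ i<y)
  sound′ (there c∈)  = Extendable-suc (inj₂ (sym x≡mi)) (sound c∈)
  complete′ : ∀ {c} → Extendable m (suc i) c → c ∈ i ∷ cs
  complete′ ext with <suc-cases (proj₁ ext)
  ... | inj₁ refl = here refl
  ... | inj₂ c<i  = there (complete (Extendable-pred c<i ext))
-- Using one label closes all the others: if a second one were used later, the larger of the two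
-- would have become a bad opener.
... | false | ofⁿ x≢i | true | ofʸ x∈ | refl | at≡′ =
  GoodFrom-suc (inj₂ (sound x∈)) (run-reflects xs at≡′ sound′ complete′)
  where
  sound′ : ∀ {c} → c ∈ m i ∷ [] → Extendable m (suc i) c
  sound′ (here refl) = Extendable-suc (inj₁ refl) (sound x∈)
  complete′ : ∀ {c} → Extendable m (suc i) c → c ∈ m i ∷ []
  complete′ (c<1+i , mc , between) with <suc-cases c<1+i
  ... | inj₁ refl = contradiction mc x≢i
  ... | inj₂ c<i with between c<i ≤-refl
  ...   | inj₁ mi≡c = here (sym mi≡c)
  ...   | inj₂ mi≡i = contradiction mi≡i x≢i
... | false | ofⁿ x≢i | false | ofⁿ x∉ | refl | _ = ofⁿ λ h → bad (h i ≤-refl (s≤s (m≤n+m i (length xs))))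
  where
  bad : ¬ Good m i
  bad (inj₁ mi≡i) = x≢i mi≡i
  bad (inj₂ ext)  = x∉ (complete ext)

-- Both recurrences split on the next label. With no listed label reused, it must be new, and this
-- new label is later reused (`B r`) or not (`A r`). With a given label reused, either a new one
-- comes first (`B r`), or the given one is used now and becomes the only one available
-- (`A r + B r`). The values are the Fibonacci numbers of odd index for `A` and of even index for
-- `B`.
A B : ℕ → ℕ
A zero    = 1
A (suc r) = A r + B r
B zero    = 0
B (suc r) = A r + 2 * B r

A≡oddFib : ∀ r → A r ≡ oddFib r
A≡oddFib zero = refl
A≡oddFib (suc zero) = refl
A≡oddFib (suc (suc r)) = begin
  -- Adding and removing `A r` eliminates `B` and keeps the truncated subtraction exact.
  A r + B r + (A r + 2 * B r)                        ≡⟨ m+n∸n≡m _ (A r) ⟨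
  A r + B r + (A r + 2 * B r) + A r ∸ A r            ≡⟨ cong (_∸ A r) (triple (A r) (B r)) ⟩
  3 * A (suc r) ∸ A r                                ≡⟨ cong₂ (λ x y → 3 * x ∸ y) (A≡oddFib (suc r)) (A≡oddFib r) ⟩
  3 * oddFib (suc r) ∸ oddFib r                      ∎
  where
  open ≡-Reasoning
  triple : ∀ a b → a + b + (a + 2 * b) + a ≡ 3 * (a + b)
  triple = solve-∀

∑-member : ∀ {n cs} c → Unique cs → (∀ {x} → x ∈ cs → x < n) →
           ∑ (upTo n) (λ x → if member x cs then c else 0) ≡ length cs * c
∑-member {n} {[]} c _ _ = ∑-zero (upTo n) λ _ _ → refl
∑-member {n} {d ∷ cs} c (d∉ ∷ u) bound = begin
  ∑ els (λ x → if member x (d ∷ cs) then c else 0)    ≡⟨ ∑-cong els (λ x _ → split x) ⟩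
  ∑ els (λ x → at-d x + in-cs x)                      ≡⟨ ∑-distrib-+ els at-d in-cs ⟩
  ∑ els at-d + ∑ els in-cs                            ≡⟨ cong₂ _+_ at-d-sum (∑-member c u (bound ∘ there)) ⟩
  c + length cs * c                                   ∎
  where
  open ≡-Reasoning
  els = upTo n
  at-d in-cs : ℕ → ℕ
  at-d x = if x ≡ᵇ d then c else 0
  in-cs x = if member x cs then c else 0
  split : ∀ x → (if member x (d ∷ cs) then c else 0) ≡ at-d x + in-cs x
  split x with x ≡ᵇ d | ≡ᵇ-reflects x d | member x cs | member-reflects x cs
  ... | false | _        | _     | _       = refl
  ... | true  | _        | false | _       = sym (+-identityʳ c)
  ... | true  | ofʸ refl | true  | ofʸ x∈  = contradiction refl (All.lookup d∉ x∈)
  at-d-sum : ∑ els at-d ≡ c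
  at-d-sum = trans (∑-point at-d (Unique.upTo⁺ n) (∈-upTo⁺ (bound (here refl))) (λ x _ x≢d → off x x≢d)) on
    where
    off : ∀ x → x ≢ d → at-d x ≡ 0
    off x x≢d with x ≡ᵇ d | ≡ᵇ-reflects x d
    ... | true  | ofʸ x≡d = contradiction x≡d x≢d
    ... | false | _ = refl
    on : at-d d ≡ c
    on with d ≡ᵇ d | ≡ᵇ-reflects d d
    ... | true  | _ = refl
    ... | false | ofⁿ d≢d = contradiction refl d≢d

-- At most one of the labels in cs is used again: A r counts the completions
-- of length r that use none of them, B r those that use a given one.
run-count : ∀ {n} r {i cs} → i + r ≡ n → Unique cs → (∀ {c} → c ∈ cs → c < i) →
            ∑ (vecsBelow r n) (λ v → 𝟙 (run i cs (toList v))) ≡ A r + length cs * B r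
run-count zero {cs = cs} _ _ _ = cong suc (sym (*-zeroʳ (length cs)))
run-count {n} (suc r) {i} {cs} i+r≡n u bound = begin
  ∑ (vecsBelow (suc r) n) accepted                                       ≡⟨ ∑-concatMap (λ x → map (x Vec.∷_) (vecsBelow r n)) els accepted ⟩
  ∑ els (λ x → ∑ (map (x Vec.∷_) (vecsBelow r n)) accepted)              ≡⟨ ∑-cong els (λ x _ → trans (∑-map (x Vec.∷_) (vecsBelow r n) accepted) (split x)) ⟩
  ∑ els (λ x → new x + old x)                                            ≡⟨ ∑-distrib-+ els new old ⟩
  ∑ els new + ∑ els old                                                  ≡⟨ cong₂ _+_ new-sum (∑-member (A r + 1 * B r) u (λ c∈ → <-trans (bound c∈) i<n)) ⟩
  A r + suc (length cs) * B r + length cs * (A r + 1 * B r)              ≡⟨ recurrence (A r) (B r) (length cs) ⟩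
  A (suc r) + length cs * B (suc r)                                      ∎
  where
  open ≡-Reasoning
  els = upTo n
  accepted : Vec ℕ (suc r) → ℕ
  accepted v = 𝟙 (run i cs (toList v))
  new old : ℕ → ℕ
  -- Written with `member` so that `∑-member` evaluates both sums; `1 * B r` in `old` is what the
  -- recursive call returns for a list of one label.
  new x = if member x (i ∷ []) then A r + suc (length cs) * B r else 0
  old x = if member x cs then A r + 1 * B r else 0
  i<n : i < n
  i<n = subst (i <_) i+r≡n (m<m+n i z<s)
  i+r≡n′ : suc i + r ≡ n
  i+r≡n′ = trans (sym (+-suc i r)) i+r≡n
  i∉cs : All (i ≢_) cs
  i∉cs = All.tabulate λ c∈ → ≢-sym (<⇒≢ (bound c∈))
  split : ∀ x → ∑ (vecsBelow r n) (accepted ∘ (x Vec.∷_)) ≡ new x + old x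
  split x with x ≡ᵇ i | ≡ᵇ-reflects x i | member x cs | member-reflects x cs
  ... | true  | ofʸ refl | true  | ofʸ x∈ = contradiction (bound x∈) (<-irrefl refl)
  ... | true  | ofʸ refl | false | _      = trans
    (run-count r i+r≡n′ (i∉cs ∷ u) λ { (here refl) → ≤-refl ; (there c∈) → m<n⇒m<1+n (bound c∈) })
    (sym (+-identityʳ _))
  ... | false | _        | true  | ofʸ x∈ =
    run-count r i+r≡n′ ([] ∷ []) λ { (here refl) → m<n⇒m<1+n (bound x∈) }
  ... | false | _        | false | _      = ∑-zero (vecsBelow r n) λ _ _ → refl
  new-sum : ∑ els new ≡ A r + suc (length cs) * B r
  new-sum = trans (∑-member _ ([] ∷ []) λ { (here refl) → i<n }) (*-identityˡ _)
  recurrence : ∀ a b t → a + suc t * b + t * (a + 1 * b) ≡ a + b + t * (a + 2 * b)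
  recurrence = solve-∀

flat-count : ∀ n → countᵇ flatᵇ (allΠ n) ≡ oddFib n
flat-count n = begin
  countᵇ flatᵇ (allΠ n)                                  ≡⟨ count-∑ flatᵇ (allΠ n) ⟩
  ∑ (allΠ n) (𝟙 ∘ flatᵇ)                                 ≡⟨ ∑-collect (vecsBelow n n) (λ π → cong 𝟙 (reflects⇒≡
    (flatᵇ-reflects π) (accepts (vec π)) (flat⇒good (word-valid π)) good⇒flat))
    (λ v ¬valid → 𝟙-false (λ good → ¬valid (reflects⇒T (validL-reflects n (toList v)) (good⇒valid good))) (accepts v)) ⟩
  ∑ (vecsBelow n n) (λ v → 𝟙 (run 0 [] (toList v)))      ≡⟨ run-count n refl [] (λ ()) ⟩
  A n + 0                                                ≡⟨ +-identityʳ (A n) ⟩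
  A n                                                    ≡⟨ A≡oddFib n ⟩
  oddFib n                                               ∎
  where
  open ≡-Reasoning
  accepts : (v : Vec ℕ n) → Reflects (∀ i → i < n → Good (at (toList v)) i) (run 0 [] (toList v))
  accepts v = reflects-map
    (λ h i i<n → h i z≤n (subst (i <_) (sym len) i<n)) (λ h i _ i<n → h i (subst (i <_) len i<n))
    (run-reflects {at (toList v)} (toList v) (λ k _ → cong (at (toList v)) (sym (+-identityʳ k))) (λ ()) (λ ()))
    where
    len : length (toList v) + 0 ≡ n
    len = trans (+-identityʳ _) (length-toList v)

theorem4p4 : (s : Statistic) → ExhibitsCSP s oddFib
theorem4p4 s n φ _ fixed≡ =
  genPoly-1 s n , trans (genPoly-−1 s n) (cong pos (trans (flat-count n) (sym fixed≡)))
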